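{- Let $k\le \ell\le 2k-1$. A graph $G$ with $n$ vertices is a $(k,\ell)$-pebble-game graph that is $(k,\ell)$-tight if and only if $G$ has a proper $\ell\mathsf{T}k$ decomposition and has $kn-\ell$ edges.
   Context: A graph means a finite multigraph, possibly with loops. A graph is $(k,\ell)$-sparse if every subgraph with $n'$ vertices and $m'\ge1$ edges has $m'\le kn'-\ell$. It is $(k,\ell)$-tight if it is $(k,\ell)$-sparse with exactly $kn-\ell$ edges. An $\ell\mathsf{T}k$ decomposition of $G$ is a partition of $E(G)$ into the edge sets of $\ell$ trees $T_1,\dots,T_\ell$. The trees are subgraphs of $G$, not necessarily spanning, and a tree may be a single vertex. Every vertex of $G$ must lie in exactly $k$ of the trees. For a subgraph $G'=(V',E')$ of $G$, the tree-pieces of $G'$ are the connected components of the graphs $(V(T_j)\cap V',\,E(T_j)\cap E')$ for $j=1,\dots,\ell$, counted separately for each $j$. The decomposition is proper if every non-empty subgraph $G'$ of $G$ that has at least one edge or satisfies $\ell\le k$ has at least $\ell$ tree-pieces. The $(k,\ell)$-pebble game with colors is played on a fixed finite vertex set $V$. Its state is a directed multigraph $H$ on $V$ (loops allowed) together with pebbles, each having one of $k$ colors $c_1,\dots,c_k$. Each pebble lies on a vertex or on an edge, and every edge carries exactly one pebble. Initially $H$ has no edges and each vertex carries one pebble of each color. Moves: (add-edge) Let $v,w$ be vertices, not necessarily distinct, whose set $\{v,w\}$ carries at least $\ell+1$ pebbles in total, with $v$ carrying at least one pebble. Pick up a pebble from $v$, add the directed edge $vw$, and put that pebble on it. (pebble-slide)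 Let $w$ carry a pebble $p$ and let $vw$ be an edge. Replace $vw$ by $wv$, put the pebble from $vw$ onto $v$, and put $p$ on $wv$. $G$ is a $(k,\ell)$-pebble-game graph if it is the underlying undirected graph of some $H$ reachable from the initial configuration on $V(G)$ by finitely many moves. -}

module Defs where

open import Data.Nat using (ℕ; zero; suc; _+_; _*_; _≤_; _<_)
open import Data.Nat.ListAction using (sum)
open import Data.Fin using (Fin; zero; suc; inject₁; fromℕ; _≟_)
open import Data.Fin.Subset using (Subset; _∈_; ∣_∣; Nonempty)
open import Data.Vec using (tabulate; lookup)
open import Data.List using (List; []; _∷_; _++_; map; allFin; length)
open import Data.Bool using (if_then_else_; _∧_)
open import Data.Product using (Σ; ∃; _×_; _,_; proj₁; proj₂)
open import Data.Sum using (_⊎_)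
open import Relation.Nullary using (¬_; does)
open import Relation.Binary.PropositionalEquality using (_≡_; _≢_)
open import Relation.Binary.Construct.Closure.ReflexiveTransitive using (Star)
open import Function.Definitions using (Injective)
open import Function.Bundles using (_⤖_; module Bijection)

-- Finite multigraphs (loops and parallel edges allowed).
-- Vertices are Fin n, edges are Fin m, and edge e has the (unordered)
-- endpoints given by the pair  ends e  (the order in the pair is
-- irrelevant; all notions below treat it symmetrically).

record Graph : Set where
  constructor graph
  field
    n    : ℕ
    m    : ℕ
    ends : Fin m → Fin n × Fin n

open Graph public

module _ (G : Graph) where

  Joins : Fin (m G) → Fin (n G) → Fin (n G) → Set
  Joins e x y = (ends G e ≡ (x , y)) ⊎ (ends G e ≡ (y , x))

  IsSubgraph : Subset (n G) → Subset (m G) → Set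
  IsSubgraph V' E' = ∀ e → e ∈ E' →
    (proj₁ (ends G e) ∈ V') × (proj₂ (ends G e) ∈ V')

  -- (k,ℓ)-sparse: every subgraph with n' vertices and m' ≥ 1 edges
  -- has m' ≤ k n' - ℓ  (stated without truncated subtraction)
  Sparse : ℕ → ℕ → Set
  Sparse k ℓ = ∀ (V' : Subset (n G)) (E' : Subset (m G)) →
    IsSubgraph V' E' → 1 ≤ ∣ E' ∣ → ∣ E' ∣ + ℓ ≤ k * ∣ V' ∣

  HasTightCount : ℕ → ℕ → Set
  HasTightCount k ℓ = m G + ℓ ≡ k * n G

  Tight : ℕ → ℕ → Set
  Tight k ℓ = Sparse k ℓ × HasTightCount k ℓ

  data Reach (E : Fin (m G) → Set) (x : Fin (n G)) : Fin (n G) → Set where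
    here : Reach E x x
    step : ∀ {y z} e → Reach E x y → E e → Joins e y z → Reach E x z

  -- a cycle of length r+1 in the edge set E: distinct vertices
  -- v_0..v_r and distinct edges e_0..e_r of E, e_i joining v_i and
  -- v_{i+1}, and e_r joining v_r and v_0.  (Length 1 = loop,
  -- length 2 = pair of parallel edges.)
  record Cycle (E : Fin (m G) → Set) : Set where
    field
      r      : ℕ
      vs     : Fin (suc r) → Fin (n G)
      es     : Fin (suc r) → Fin (m G)
      vs-inj : Injective _≡_ _≡_ vs
      es-inj : Injective _≡_ _≡_ es
      es-in  : ∀ i → E (es i)
      joins  : ∀ (i : Fin r) → Joins (es (inject₁ i)) (vs (inject₁ i)) (vs (suc i))
      close  : Joins (es (fromℕ r)) (vs (fromℕ r)) (vs zero)

  -- (V , E) is a tree: non-empty, connected, acyclic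
  -- (assumes the edges of E have their ends in V)
  IsTree : Subset (n G) → (Fin (m G) → Set) → Set
  IsTree V E =
    Nonempty V ×
    (∀ x y → x ∈ V → y ∈ V → Reach E x y) ×
    ¬ Cycle E

  -- an ℓTk decomposition: trees T_1..T_ℓ given by vertex sets
  -- treeV j and edge sets {e | col e ≡ j} (so the edge sets
  -- partition E(G)); each vertex lies in exactly k trees.
  record Decomposition (k ℓ : ℕ) : Set where
    field
      col     : Fin (m G) → Fin ℓ
      treeV   : Fin ℓ → Subset (n G)
      sub     : ∀ j → IsSubgraph (treeV j) (tabulate (λ e → does (col e ≟ j)))
      isTree  : ∀ j → IsTree (treeV j) (λ e → col e ≡ j)
      k-trees : ∀ v → ∣ tabulate (λ j → lookup (treeV j) v) ∣ ≡ k

  module _ {k ℓ : ℕ} (D : Decomposition k ℓ) where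
    open Decomposition D

    PieceEdge : Subset (m G) → Fin ℓ → Fin (m G) → Set
    PieceEdge E' j e = (col e ≡ j) × (e ∈ E')

    -- G' = (V', E') has at least p tree-pieces: one can choose p
    -- representatives (j , v) with v a vertex of the graph
    -- (V(T_j) ∩ V' , E(T_j) ∩ E') such that two distinct
    -- representatives with the same j lie in different components.
    AtLeastPieces : ℕ → Subset (n G) → Subset (m G) → Set
    AtLeastPieces p V' E' =
      Σ (Fin p → Fin ℓ × Fin (n G)) λ f →
        (∀ i → (proj₂ (f i) ∈ treeV (proj₁ (f i))) × (proj₂ (f i) ∈ V')) ×
        (∀ i i' → i ≢ i' → proj₁ (f i) ≡ proj₁ (f i') →
           ¬ Reach (PieceEdge E' (proj₁ (f i))) (proj₂ (f i)) (proj₂ (f i')))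

    Proper : Set
    Proper = ∀ (V' : Subset (n G)) (E' : Subset (m G)) →
      IsSubgraph V' E' → Nonempty V' → (Nonempty E' ⊎ ℓ ≤ k) →
      AtLeastPieces ℓ V' E'

  HasProperDecomposition : ℕ → ℕ → Set
  HasProperDecomposition k ℓ = Σ (Decomposition k ℓ) Proper

-- The (k,ℓ)-pebble game with colors on vertex set Fin N.
-- A state: the directed edges of H, each with the color of the pebble
-- on it (tail , head , color), and for each vertex and color the
-- number of pebbles of that color on that vertex.

record PState (N k : ℕ) : Set where
  constructor pstate
  field
    edges : List (Fin N × Fin N × Fin k)
    peb   : Fin N → Fin k → ℕ

open PState public

module _ {N k : ℕ} where

  setPeb : (Fin N → Fin k → ℕ) → Fin N → Fin k → ℕ → (Fin N → Fin k → ℕ)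
  setPeb p v c a u d = if does (u ≟ v) ∧ does (d ≟ c) then a else p u d

  total : (Fin N → Fin k → ℕ) → Fin N → ℕ
  total p v = sum (map (p v) (allFin k))

  onPair : (Fin N → Fin k → ℕ) → Fin N → Fin N → ℕ
  onPair p v w = if does (v ≟ w) then total p v else total p v + total p w

  initial : PState N k
  initial = pstate [] (λ _ _ → 1)

  data Move (ℓ : ℕ) : PState N k → PState N k → Set where
    add-edge : ∀ {es p} v w c a →
      p v c ≡ suc a →
      suc ℓ ≤ onPair p v w →
      Move ℓ (pstate es p) (pstate ((v , w , c) ∷ es) (setPeb p v c a))
    pebble-slide : ∀ {p} xs ys v w c c' a →
      p w c ≡ suc a →
      Move ℓ (pstate (xs ++ (v , w , c') ∷ ys) p)
             (pstate (xs ++ (w , v , c) ∷ ys)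
                     (setPeb (setPeb p w c a) v c'
                             (suc (setPeb p w c a v c'))))

  Reachable : ℕ → PState N k → Set
  Reachable ℓ = Star (Move ℓ) initial

lookupL : ∀ {A : Set} (xs : List A) → Fin (length xs) → A
lookupL (x ∷ xs) zero    = x
lookupL (x ∷ xs) (suc i) = lookupL xs i

PebbleGameGraph : ℕ → ℕ → Graph → Set
PebbleGameGraph k ℓ G =
  Σ (PState (n G) k) λ s → Reachable ℓ s ×
  Σ (Fin (m G) ⤖ Fin (length (edges s))) λ β →
    ∀ e → let h = lookupL (edges s) (Bijection.to β e) in
      Joins G e (proj₁ h) (proj₁ (proj₂ h))

{-# OPTIONS --safe #-}
module Submission where

-- Call a state of the pebble game canonical if every vertex owns exactly one token of each colour
-- (a pebble on it or an edge leaving it) and every colour class is acyclic, i.e. a forest whose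
-- roots carry the pebbles of that colour. Every (k,ℓ)-sparse graph with k ≤ ℓ is built by playing
-- through canonical states only. If fewer than ℓ + 1 pebbles lie on {v , w}, sparsity yields a
-- directed path from v or w to a further pebble, which can be brought back along the path; when a
-- slide would close a monochromatic cycle, the pebble is instead passed along its own tree, which
-- merely re-roots that tree. Once ℓ + 1 > k pebbles lie on {v , w}, two of them share a colour,
-- and the new edge in that colour joins two trees.
--
-- In a canonical state with kn − ℓ edges exactly ℓ pebbles are left, so the colour classes consist
-- of ℓ trees covering each vertex k times. A subgraph with n′ vertices and m′ edges has kn′ − m′
-- tree-pieces, since forests have as many components as vertices minus edges; hence the
-- decomposition is proper by sparsity. The same count shows that a graph with a proper
-- decomposition is sparse, and then the game builds it.

open import Defs
open import Data.Nat using (ℕ; zero; suc; _+_; _*_; _≤_; _<_; z≤n; s≤s; s≤s⁻¹; _≤?_)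
open import Data.Nat.Properties hiding (_≟_)
import Data.Nat.ListAction as ListAction
open import Data.Fin using (Fin; zero; suc; _≟_; toℕ; cast; inject₁; fromℕ; inject≤)
import Data.Fin.Properties as Fin
open import Data.Fin.Relation.Unary.Top using (view; ‵fromℕ; ‵inj₁; view-inject₁; view-fromℕ)
open import Data.Fin.Subset using (Subset; ∣_∣; Nonempty) renaming (_∈_ to _∈ˢ_)
open import Data.Bool using (Bool; true; false; if_then_else_; _∧_; _∨_; not)
open import Data.Bool.Properties using (∧-comm; ∧-zeroʳ; ∧-identityʳ; ∨-zeroʳ) renaming (_≟_ to _≟ᵇ_)
open import Data.Vec as Vec using (tabulate; lookup)
open import Data.Vec.Properties using (lookup∘tabulate; lookup⇒[]=; []=⇒lookup)
open import Data.List as List using (List; []; _∷_; _++_; map; filter; length; allFin; cartesianProduct)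
open import Data.List.Properties using (filter-++; length-++; length-tabulate; map-tabulate)
open import Data.List.Membership.Propositional using (_∈_; find; lose)
open import Data.List.Membership.Propositional.Properties using (∈-filter⁺; ∈-filter⁻; ∈-cartesianProduct⁺; ∈-allFin; ∈-lookup; ∈-∃++; ∈-tabulate⁺; ∈-tabulate⁻)
open import Data.List.Relation.Unary.Any using (here; there; any?; index)
open import Data.List.Relation.Unary.Any.Properties using (lookup-index)
open import Data.List.Relation.Unary.All as All using (All; []; _∷_)
open import Data.List.Relation.Unary.AllPairs using ([]; _∷_)
open import Data.List.Relation.Unary.Unique.Propositional using (Unique)
open import Data.List.Relation.Unary.Unique.Propositional.Properties using (filter⁺; cartesianProduct⁺; allFin⁺)
open import Data.List.Relation.Binary.Pointwise using (Pointwise; []; _∷_)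
open import Data.Product using (Σ; ∃; ∃₂; _×_; _,_; proj₁; proj₂)
open import Data.Sum using (_⊎_; inj₁; inj₂; [_,_]′; swap)
open import Data.Empty using (⊥)
open import Function using (_∘_; id)
open import Function.Bundles using (_⇔_; mk⇔; _⤖_; mk↔ₛ′)
open import Function.Definitions using (Injective)
open import Function.Properties.Inverse using (↔⇒⤖)
open import Relation.Nullary using (¬_; Dec; does; yes; no; contradiction)
open import Relation.Nullary.Decidable using (dec-true; dec-false; _×-dec_; ¬?)
open import Relation.Binary.PropositionalEquality
open import Relation.Binary.Construct.Closure.ReflexiveTransitive as Star using (Star; ε; _◅_; _◅◅_)
open import Algebra.Properties.CommutativeMonoid.Sum +-0-commutativeMonoid using (sum; sum-cong-≗; ∑-distrib-+; ∑-comm)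
open import Algebra.Properties.CommutativeSemigroup +-commutativeSemigroup using (interchange; x∙yz≈y∙xz; xy∙z≈xz∙y)
open import Algebra.Properties.Semiring.Sum +-*-semiring using (*-distribˡ-sum)

-- Sums and enumerations

⟦_⟧ : Bool → ℕ
⟦ b ⟧ = if b then 1 else 0

⟦⟧≤1 : ∀ b → ⟦ b ⟧ ≤ 1
⟦⟧≤1 true  = ≤-refl
⟦⟧≤1 false = z≤n

-- The test inside `setPeb`, so that a change of pebbles and its bookkeeping split into the same
-- cases.
at : ∀ {a b} → Fin a → Fin b → Fin a → Fin b → Bool
at v c u d = does (u ≟ v) ∧ does (d ≟ c)

at-refl : ∀ {a b} (v : Fin a) (c : Fin b) → at v c v c ≡ true
at-refl v c rewrite dec-true (v ≟ v) refl | dec-true (c ≟ c) refl = refl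

at-sound : ∀ {a b} (v u : Fin a) (c d : Fin b) → at v c u d ≡ true → u ≡ v × d ≡ c
at-sound v u c d eq with u ≟ v | d ≟ c
... | yes p | yes q = p , q
at-sound v u c d () | yes _ | no _
at-sound v u c d () | no _  | _

at-false : ∀ {a b} {v u : Fin a} {c d : Fin b} → ¬ (u ≡ v × d ≡ c) → at v c u d ≡ false
at-false {v = v} {u} {c} {d} h with at v c u d in eq
... | true  = contradiction (at-sound v u c d eq) h
... | false = refl

sum-const : ∀ n a → sum {n} (λ _ → a) ≡ n * a
sum-const zero    a = refl
sum-const (suc n) a = cong (a +_) (sum-const n a)

sum-zero : ∀ {n} {f : Fin n → ℕ} → (∀ i → f i ≡ 0) → sum f ≡ 0
sum-zero {n} h = trans (sum-cong-≗ h) (trans (sum-const n 0) (*-zeroʳ n))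

sum-mono : ∀ {n} {f g : Fin n → ℕ} → (∀ i → f i ≤ g i) → sum f ≤ sum g
sum-mono {zero}  h = z≤n
sum-mono {suc n} h = +-mono-≤ (h zero) (sum-mono (h ∘ suc))

sum-single : ∀ {n} (i : Fin n) {f : Fin n → ℕ} → (∀ j → j ≢ i → f j ≡ 0) → sum f ≡ f i
sum-single zero    {f} h =
  trans (cong (f zero +_) (sum-zero (λ j → h (suc j) λ ()))) (+-identityʳ _)
sum-single (suc i) {f} h =
  trans (cong (_+ sum (f ∘ suc)) (h zero λ ()))
        (sum-single i (λ j j≢i → h (suc j) (j≢i ∘ Fin.suc-injective)))

term≤sum : ∀ {n} (f : Fin n → ℕ) i → f i ≤ sum f
term≤sum f zero    = m≤m+n _ _
term≤sum f (suc i) = ≤-trans (term≤sum (f ∘ suc) i) (m≤n+m _ _)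

two≤sum : ∀ {n} (f : Fin n → ℕ) {i j} → i ≢ j → f i + f j ≤ sum f
two≤sum f {zero}  {zero}  h = contradiction refl h
two≤sum f {zero}  {suc j} h = +-monoʳ-≤ (f zero) (term≤sum (f ∘ suc) j)
two≤sum f {suc i} {zero}  h =
  ≤-trans (≤-reflexive (+-comm (f (suc i)) _)) (+-monoʳ-≤ (f zero) (term≤sum (f ∘ suc) i))
two≤sum f {suc i} {suc j} h =
  ≤-trans (two≤sum (f ∘ suc) (h ∘ cong suc)) (m≤n+m _ _)

sum-positive : ∀ {n} (f : Fin n → ℕ) → 1 ≤ sum f → ∃ λ i → 1 ≤ f i
sum-positive {suc n} f h with f zero in eq
... | suc _ = zero , subst (1 ≤_) (sym eq) (s≤s z≤n)
... | zero  with i , p ← sum-positive (f ∘ suc) h = suc i , p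

sum-indicator : ∀ {n} (v : Fin n) → sum (λ u → ⟦ does (u ≟ v) ⟧) ≡ 1
sum-indicator v =
  trans (sum-single v (λ u u≢v → cong ⟦_⟧ (dec-false (u ≟ v) u≢v)))
        (cong ⟦_⟧ (dec-true (v ≟ v) refl))

sum-pick : ∀ {n} (f : Fin n → ℕ) v → sum (λ u → f u * ⟦ does (u ≟ v) ⟧) ≡ f v
sum-pick f v = trans
  (sum-single v (λ u u≢v → trans (cong (λ b → f u * ⟦ b ⟧) (dec-false (u ≟ v) u≢v)) (*-zeroʳ (f u))))
  (trans (cong (λ b → f v * ⟦ b ⟧) (dec-true (v ≟ v) refl)) (*-identityʳ (f v)))

sum-at : ∀ {a b} (v : Fin a) (c : Fin b) u → sum (λ d → ⟦ at v c u d ⟧) ≡ ⟦ does (u ≟ v) ⟧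
sum-at {b = b} v c u with does (u ≟ v)
... | true  = sum-indicator c
... | false = sum-zero {b} {λ _ → 0} (λ _ → refl)

sum₂ : ∀ {a b} → (Fin a → Fin b → ℕ) → ℕ
sum₂ f = sum (λ i → sum (f i))

sum₂-cong : ∀ {a b} {f g : Fin a → Fin b → ℕ} → (∀ i j → f i j ≡ g i j) → sum₂ f ≡ sum₂ g
sum₂-cong h = sum-cong-≗ (λ i → sum-cong-≗ (h i))

sum₂-+ : ∀ {a b} (f g : Fin a → Fin b → ℕ) → sum₂ (λ i j → f i j + g i j) ≡ sum₂ f + sum₂ g
sum₂-+ f g = trans (sum-cong-≗ (λ i → ∑-distrib-+ (f i) (g i)))
                   (∑-distrib-+ (sum ∘ f) (sum ∘ g))

sum₂-at : ∀ {a b} (v : Fin a) (c : Fin b) → sum₂ (λ u d → ⟦ at v c u d ⟧) ≡ 1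
sum₂-at v c = trans (sum-cong-≗ (sum-at v c)) (sum-indicator v)

∣∣-sum : ∀ {n} (S : Subset n) → ∣ S ∣ ≡ sum (λ i → ⟦ lookup S i ⟧)
∣∣-sum Vec.[]            = refl
∣∣-sum (true  Vec.∷ S) = cong suc (∣∣-sum S)
∣∣-sum (false Vec.∷ S) = ∣∣-sum S

∣tabulate∣ : ∀ {n} (f : Fin n → Bool) → ∣ tabulate f ∣ ≡ sum (λ i → ⟦ f i ⟧)
∣tabulate∣ {zero}  f = refl
∣tabulate∣ {suc n} f with f zero
... | true  = cong suc (∣tabulate∣ (f ∘ suc))
... | false = ∣tabulate∣ (f ∘ suc)

unique-lookup-injective : ∀ {A : Set} {xs : List A} → Unique xs → Injective _≡_ _≡_ (List.lookup xs)
unique-lookup-injective (x∉ ∷ u) {zero}  {zero}  eq = refl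
unique-lookup-injective {xs = x ∷ xs} (x∉ ∷ u) {zero}  {suc j} eq = contradiction eq (All.lookup x∉ (∈-lookup {xs = xs} j))
unique-lookup-injective {xs = x ∷ xs} (x∉ ∷ u) {suc i} {zero}  eq = contradiction (sym eq) (All.lookup x∉ (∈-lookup {xs = xs} i))
unique-lookup-injective (x∉ ∷ u) {suc i} {suc j} eq = cong suc (unique-lookup-injective u eq)

length-filter-tabulate : ∀ {A : Set} (q : A → Bool) {s} (g : Fin s → A) →
  length (filter (λ x → q x ≟ᵇ true) (List.tabulate g)) ≡ sum (λ j → ⟦ q (g j) ⟧)
length-filter-tabulate q {zero}  g = refl
length-filter-tabulate q {suc s} g with q (g zero)
... | true  = cong suc (length-filter-tabulate q (g ∘ suc))
... | false = length-filter-tabulate q (g ∘ suc)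

module _ {a b : ℕ} (q : Fin a → Fin b → Bool) where

  private
    q? = λ (x : Fin a × Fin b) → q (proj₁ x) (proj₂ x) ≟ᵇ true

    pairs : List (Fin a × Fin b)
    pairs = filter q? (cartesianProduct (allFin a) (allFin b))

    row : ∀ i → length (filter q? (map (i ,_) (allFin b))) ≡ sum (λ j → ⟦ q i j ⟧)
    row i = trans (cong (length ∘ filter q?) (map-tabulate (λ j → j) (i ,_)))
                  (length-filter-tabulate (λ (i , j) → q i j) (i ,_))

    length-rows : ∀ {s} (g : Fin s → Fin a) →
      length (filter q? (cartesianProduct (List.tabulate g) (allFin b))) ≡ sum₂ (λ i j → ⟦ q (g i) j ⟧)
    length-rows {zero}  g = refl
    length-rows {suc s} g =
      trans (cong length (filter-++ q? (map (g zero ,_) (allFin b)) _))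
     (trans (length-++ (filter q? (map (g zero ,_) (allFin b))))
            (cong₂ _+_ (row (g zero)) (length-rows (g ∘ suc))))

  -- Turns a count into indices: numbering the pebbles of a final state this way is what indexes its
  -- trees by `Fin ℓ`.
  record Enumeration (s : ℕ) : Set where
    field
      enum     : Fin s → Fin a × Fin b
      injective : Injective _≡_ _≡_ enum
      sound    : ∀ i → q (proj₁ (enum i)) (proj₂ (enum i)) ≡ true
      complete : ∀ x → q (proj₁ x) (proj₂ x) ≡ true → ∃ λ i → enum i ≡ x

  enumerate : Enumeration (sum₂ (λ i j → ⟦ q i j ⟧))
  enumerate = subst Enumeration (length-rows (λ i → i)) record
    { enum      = List.lookup pairs
    ; injective = unique-lookup-injective
        (filter⁺ q? (cartesianProduct⁺ (allFin⁺ a) (allFin⁺ b)))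
    ; sound     = λ i → proj₂ (∈-filter⁻ q? {xs = cartesianProduct (allFin a) (allFin b)} (∈-lookup {xs = pairs} i))
    ; complete  = λ (i , j) h →
        let x∈ = ∈-filter⁺ q? (∈-cartesianProduct⁺ (∈-allFin i) (∈-allFin j)) h
        in index x∈ , sym (lookup-index x∈)
    }

  injection⇒≤sum₂ : ∀ {s} (f : Fin s → Fin a × Fin b) → Injective _≡_ _≡_ f →
    (∀ i → q (proj₁ (f i)) (proj₂ (f i)) ≡ true) → s ≤ sum₂ (λ i j → ⟦ q i j ⟧)
  injection⇒≤sum₂ f f-inj f-q = Fin.injective⇒≤ {f = idx} λ {i} {j} eq →
    f-inj (trans (sym (proj₂ (complete (f i) (f-q i))))
                 (trans (cong enum eq) (proj₂ (complete (f j) (f-q j)))))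
    where
    open Enumeration enumerate
    idx = λ i → proj₁ (complete (f i) (f-q i))

-- Bounded paths and lists

-- The index only bounds the length, so a path cut short keeps its index; it is the termination
-- measure for moving pebbles.
data Within {A : Set} (R : A → A → Set) : ℕ → A → A → Set where
  []  : ∀ {d x} → Within R d x x
  _∷_ : ∀ {d x y z} → R x y → Within R d y z → Within R (suc d) x z

within : ∀ {A : Set} {R : A → A → Set} {x y} → Star R x y → ∃ λ d → Within R d x y
within ε       = 0 , []
within (r ◅ p) = let d , q = within p in suc d , r ∷ q

-- A pebble sits at the end of its path, so slides consume the path from its last edge.
unsnoc : ∀ {A : Set} {R : A → A → Set} {d x z} → Within R d x z →
  x ≡ z ⊎ ∃₂ λ d′ y → d ≡ suc d′ × Within R d′ x y × R y z
unsnoc [] = inj₁ refl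
unsnoc (r ∷ p) with unsnoc p
... | inj₁ refl = inj₂ (_ , _ , refl , [] , r)
... | inj₂ (d , y , refl , q , r′) = inj₂ (_ , y , refl , r ∷ q , r′)

-- A slide removes a single edge, and that edge leaves v. A walk to v that would use it is at v
-- already and can stop there.
truncate : ∀ {A : Set} {R R′ : A → A → Set} {v} → (∀ {a b} → R a b → a ≡ v ⊎ R′ a b) →
  ∀ {d x} → Within R d x v → Within R′ d x v
truncate h [] = []
truncate h (r ∷ p) with h r
... | inj₁ refl = []
... | inj₂ r′   = r′ ∷ truncate h p

mapWithin : ∀ {A : Set} {R R′ : A → A → Set} → (∀ {a b} → R a b → R′ a b) →
  ∀ {d x y} → Within R d x y → Within R′ d x y
mapWithin h []      = []
mapWithin h (r ∷ p) = h r ∷ mapWithin h p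

∈-replace : ∀ {A : Set} (xs : List A) {ys a b z} → z ∈ xs ++ a ∷ ys → z ≡ a ⊎ z ∈ xs ++ b ∷ ys
∈-replace []       (here refl) = inj₁ refl
∈-replace []       (there z∈)  = inj₂ (there z∈)
∈-replace (x ∷ xs) (here refl) = inj₂ (here refl)
∈-replace (x ∷ xs) (there z∈) with ∈-replace xs z∈
... | inj₁ eq = inj₁ eq
... | inj₂ w  = inj₂ (there w)

∈-middle : ∀ {A : Set} (xs : List A) {ys a} → a ∈ xs ++ a ∷ ys
∈-middle []       = here refl
∈-middle (x ∷ xs) = there (∈-middle xs)

module _ {N : ℕ} where

  size : (Fin N → Bool) → ℕ
  size P = sum (λ v → ⟦ P v ⟧)

  size≤N : ∀ P → size P ≤ N
  size≤N P = ≤-trans (sum-mono (λ v → ⟦⟧≤1 (P v))) (≤-reflexive (trans (sum-const N 1) (*-identityʳ N)))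

  insert : (Fin N → Bool) → Fin N → Fin N → Bool
  insert P b x = P x ∨ does (x ≟ b)

  size-insert : ∀ P {b} → P b ≡ false → size (insert P b) ≡ size P + 1
  size-insert P {b} Pb = begin
    sum (λ x → ⟦ insert P b x ⟧)                  ≡⟨ sum-cong-≗ pointwise ⟩
    sum (λ x → ⟦ P x ⟧ + ⟦ does (x ≟ b) ⟧)        ≡⟨ ∑-distrib-+ (λ x → ⟦ P x ⟧) _ ⟩
    size P + sum (λ x → ⟦ does (x ≟ b) ⟧)         ≡⟨ cong (size P +_) (sum-indicator b) ⟩
    size P + 1                                    ∎
    where
    open ≡-Reasoning
    pointwise : ∀ x → ⟦ insert P b x ⟧ ≡ ⟦ P x ⟧ + ⟦ does (x ≟ b) ⟧
    pointwise x with x ≟ b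
    ... | yes refl rewrite Pb = refl
    ... | no _ with P x
    ...   | true  = refl
    ...   | false = refl

  spanned : (Fin N → Bool) → List (Fin N × Fin N) → ℕ
  spanned P []            = 0
  spanned P ((a , b) ∷ L) = ⟦ P a ∧ P b ⟧ + spanned P L

-- Canonical states of the pebble game

module _ {N k : ℕ} where

  Arc : Set
  Arc = Fin N × Fin N × Fin k

  outdeg : List Arc → Fin N → Fin k → ℕ
  outdeg []                 v c = 0
  outdeg ((t , h , d) ∷ es) v c = ⟦ at t d v c ⟧ + outdeg es v c

  Mono : List Arc → Fin k → Fin N → Fin N → Set
  Mono es c u v = (u , v , c) ∈ es

  Leads : List Arc → Fin k → Fin N → Fin N → Set
  Leads es c = Star (Mono es c)

  Link : List Arc → Fin N → Fin N → Set
  Link es u v = ∃ λ c → (u , v , c) ∈ es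

  -- `balanced` allows at most one outgoing edge per vertex and colour. Given this, `rooted`
  -- expresses acyclicity: the walk that follows a colour never runs into a cycle but ends at a
  -- pebble.
  record Canonical (s : PState N k) : Set where
    field
      balanced : ∀ v c → peb s v c + outdeg (edges s) v c ≡ 1
      rooted   : ∀ v c → ∃ λ r → 1 ≤ peb s r c × Leads (edges s) c v r

  open Canonical

  Ends : Fin N × Fin N → Arc → Set
  Ends e (t , h , _) = e ≡ (t , h) ⊎ e ≡ (h , t)

  tot : (Fin N → Fin k → ℕ) → Fin N → ℕ
  tot p v = sum (p v)

  outdeg-middle : ∀ xs {ys t h d} v c →
    outdeg (xs ++ (t , h , d) ∷ ys) v c ≡ ⟦ at t d v c ⟧ + outdeg (xs ++ ys) v c
  outdeg-middle []                v c = refl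
  outdeg-middle ((t′ , h′ , d′) ∷ xs) {t = t} {d = d} v c =
    trans (cong (⟦ at t′ d′ v c ⟧ +_) (outdeg-middle xs v c)) (x∙yz≈y∙xz ⟦ at t′ d′ v c ⟧ ⟦ at t d v c ⟧ _)

  ∈⇒1≤outdeg : ∀ {es v w c} → (v , w , c) ∈ es → 1 ≤ outdeg es v c
  ∈⇒1≤outdeg {v = v} {c = c} (here refl) rewrite at-refl v c = s≤s z≤n
  ∈⇒1≤outdeg (there e∈) = ≤-trans (∈⇒1≤outdeg e∈) (m≤n+m _ _)

  outdeg≤1⇒unique : ∀ {es v w w′ c} → outdeg es v c ≤ 1 → (v , w , c) ∈ es → (v , w′ , c) ∈ es → w ≡ w′
  outdeg≤1⇒unique h (here refl) (here refl) = refl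
  outdeg≤1⇒unique {v = v} {c = c} h (here refl) (there q) rewrite at-refl v c =
    contradiction (∈⇒1≤outdeg q) (<⇒≱ h)
  outdeg≤1⇒unique {v = v} {c = c} h (there p) (here refl) rewrite at-refl v c =
    contradiction (∈⇒1≤outdeg p) (<⇒≱ h)
  outdeg≤1⇒unique h (there p) (there q) = outdeg≤1⇒unique (≤-trans (m≤n+m _ _) h) p q

  pick-up : ∀ (p : Fin N → Fin k → ℕ) {w c a} → p w c ≡ suc a →
    ∀ u d → setPeb p w c a u d + ⟦ at w c u d ⟧ ≡ p u d
  pick-up p {w} {c} {a} eq u d with u ≟ w | d ≟ c
  ... | yes refl | yes refl = trans (+-comm a 1) (sym eq)
  ... | yes _    | no _     = +-identityʳ _
  ... | no _     | _        = +-identityʳ _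

  put-down : ∀ (p : Fin N → Fin k → ℕ) v c u d →
    setPeb p v c (suc (p v c)) u d ≡ p u d + ⟦ at v c u d ⟧
  put-down p v c u d with u ≟ v | d ≟ c
  ... | yes refl | yes refl = +-comm 1 _
  ... | yes _    | no _     = sym (+-identityʳ _)
  ... | no _     | _        = sym (+-identityʳ _)

  module _ {s : PState N k} (can : Canonical s) where

    outdeg≤1 : ∀ v c → outdeg (edges s) v c ≤ 1
    outdeg≤1 v c = ≤-trans (m≤n+m _ _) (≤-reflexive (balanced can v c))

    peb≤1 : ∀ v c → peb s v c ≤ 1
    peb≤1 v c = ≤-trans (m≤m+n _ _) (≤-reflexive (balanced can v c))

    pebble⇒terminal : ∀ {v w c} → 1 ≤ peb s v c → ¬ (v , w , c) ∈ edges s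
    pebble⇒terminal {v} {c = c} h e∈ = <⇒≱ (s≤s (s≤s z≤n))
      (≤-trans (+-mono-≤ h (∈⇒1≤outdeg e∈)) (≤-reflexive (balanced can v c)))

    -- Outgoing edges of one colour are unique and a pebble excludes them, so both walks take the
    -- same steps and stop at the same vertex.
    root-unique : ∀ {v r r′ c} → 1 ≤ peb s r c → 1 ≤ peb s r′ c →
      Leads (edges s) c v r → Leads (edges s) c v r′ → r ≡ r′
    root-unique h h′ ε       ε        = refl
    root-unique h h′ ε       (e ◅ _)  = contradiction e (pebble⇒terminal h)
    root-unique h h′ (e ◅ _) ε        = contradiction e (pebble⇒terminal h′)
    root-unique h h′ (e ◅ p) (e′ ◅ q) with refl ← outdeg≤1⇒unique (outdeg≤1 _ _) e e′ =
      root-unique h h′ p q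

    -- As w is a root in colour c, it suffices to compare it with the root of v.
    leads? : ∀ {w c} → 1 ≤ peb s w c → ∀ v → Dec (Leads (edges s) c v w)
    leads? {w} {c} h v with r , h′ , p ← rooted can v c with r ≟ w
    ... | yes refl = yes p
    ... | no  r≢w  = no (λ q → r≢w (root-unique h′ h p q))

  -- A slide can only close a monochromatic cycle if v already leads to w in colour c ≠ c′.
  module Slide (xs ys : List Arc) (p : Fin N → Fin k → ℕ) (v w : Fin N) (c c′ : Fin k) (a : ℕ)
               (pw : p w c ≡ suc a) where

    es es′ : List Arc
    es  = xs ++ (v , w , c′) ∷ ys
    es′ = xs ++ (w , v , c) ∷ ys

    p₁ p₂ : Fin N → Fin k → ℕ
    p₁ = setPeb p w c a
    p₂ = setPeb p₁ v c′ (suc (p₁ v c′))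

    -- Terms are added on both sides instead of subtracted, which avoids separating the case (w , c)
    -- = (v , c′).
    p₂-balance : ∀ u d → p₂ u d + ⟦ at w c u d ⟧ ≡ p u d + ⟦ at v c′ u d ⟧
    p₂-balance u d = begin
      p₂ u d + ⟦ at w c u d ⟧                       ≡⟨ cong (_+ ⟦ at w c u d ⟧) (put-down p₁ v c′ u d) ⟩
      p₁ u d + ⟦ at v c′ u d ⟧ + ⟦ at w c u d ⟧     ≡⟨ xy∙z≈xz∙y (p₁ u d) _ _ ⟩
      p₁ u d + ⟦ at w c u d ⟧ + ⟦ at v c′ u d ⟧     ≡⟨ cong (_+ ⟦ at v c′ u d ⟧) (pick-up p pw u d) ⟩
      p u d + ⟦ at v c′ u d ⟧                       ∎
      where open ≡-Reasoning

    balanced′ : (∀ u d → p u d + outdeg es u d ≡ 1) → ∀ u d → p₂ u d + outdeg es′ u d ≡ 1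
    balanced′ bal u d = begin
      p₂ u d + outdeg es′ u d                                     ≡⟨ cong (p₂ u d +_) (outdeg-middle xs u d) ⟩
      p₂ u d + (⟦ at w c u d ⟧ + outdeg (xs ++ ys) u d)           ≡⟨ +-assoc (p₂ u d) _ _ ⟨
      p₂ u d + ⟦ at w c u d ⟧ + outdeg (xs ++ ys) u d             ≡⟨ cong (_+ outdeg (xs ++ ys) u d) (p₂-balance u d) ⟩
      p u d + ⟦ at v c′ u d ⟧ + outdeg (xs ++ ys) u d             ≡⟨ +-assoc (p u d) _ _ ⟩
      p u d + (⟦ at v c′ u d ⟧ + outdeg (xs ++ ys) u d)           ≡⟨ cong (p u d +_) (outdeg-middle xs u d) ⟨
      p u d + outdeg es u d                                       ≡⟨ bal u d ⟩
      1                                                           ∎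
      where open ≡-Reasoning

    kept : ∀ {z} → z ∈ es → z ≡ (v , w , c′) ⊎ z ∈ es′
    kept = ∈-replace xs

    new-pebble : 1 ≤ p₂ v c′
    new-pebble = subst (1 ≤_) (sym (put-down p₁ v c′ v c′))
      (subst (λ b → 1 ≤ p₁ v c′ + ⟦ b ⟧) (sym (at-refl v c′)) (m≤n+m 1 _))

    old-pebble : ∀ {r d} → ¬ (r ≡ w × d ≡ c) → 1 ≤ p r d → 1 ≤ p₂ r d
    old-pebble {r} {d} ne h = ≤-trans h (begin
      p r d                        ≤⟨ m≤m+n _ _ ⟩
      p r d + ⟦ at v c′ r d ⟧      ≡⟨ p₂-balance r d ⟨
      p₂ r d + ⟦ at w c r d ⟧      ≡⟨ cong (λ b → p₂ r d + ⟦ b ⟧) (at-false ne) ⟩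
      p₂ r d + 0                   ≡⟨ +-identityʳ _ ⟩
      p₂ r d                       ∎)
      where open ≤-Reasoning

    Rooted′ : Fin N → Fin k → Set
    Rooted′ u d = ∃ λ r → 1 ≤ p₂ r d × Leads es′ d u r

    -- An old walk survives up to its first use of the slid edge; it is then at v, which has just
    -- received a pebble of the colour of that edge.
    follow : ∀ {d u r} → Rooted′ r d → Leads es d u r → Rooted′ u d
    follow fin ε = fin
    follow fin (e ◅ q) with kept e
    ... | inj₁ refl = v , new-pebble , ε
    ... | inj₂ e′   = let r , h , q′ = follow fin q in r , h , e′ ◅ q′

    canonical′ : Canonical (pstate es p) → c′ ≡ c ⊎ ¬ Leads es c v w → Canonical (pstate es′ p₂)
    canonical′ can side .balanced = balanced′ (balanced can)
    canonical′ can side .rooted u d with r , h , q ← rooted can u d with (r ≟ w) ×-dec (d ≟ c)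
    ... | no ne             = follow (r , old-pebble ne h , ε) q
    ... | yes (refl , refl) = follow (at-w side) q
      where
      -- w has given up its root pebble but gained an edge to v. For equal colours v is the new
      -- root; otherwise the old root of v is not w and has kept its pebble.
      at-w : c′ ≡ c ⊎ ¬ Leads es c v w → Rooted′ w c
      at-w (inj₁ refl) = v , new-pebble , ∈-middle xs ◅ ε
      at-w (inj₂ ¬vw) with r′ , h′ , q′ ← rooted can v c =
        let r″ , h″ , q″ = follow (r′ , old-pebble (λ { (refl , _) → ¬vw q′ }) h′ , ε) q′
        in r″ , h″ , ∈-middle xs ◅ q″

    tot′ : ∀ u → tot p₂ u + ⟦ does (u ≟ w) ⟧ ≡ tot p u + ⟦ does (u ≟ v) ⟧
    tot′ u = begin
      sum (p₂ u) + ⟦ does (u ≟ w) ⟧             ≡⟨ cong (sum (p₂ u) +_) (sum-at w c u) ⟨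
      sum (p₂ u) + sum (λ d → ⟦ at w c u d ⟧)   ≡⟨ ∑-distrib-+ (p₂ u) _ ⟨
      sum (λ d → p₂ u d + ⟦ at w c u d ⟧)       ≡⟨ sum-cong-≗ (p₂-balance u) ⟩
      sum (λ d → p u d + ⟦ at v c′ u d ⟧)       ≡⟨ ∑-distrib-+ (p u) _ ⟩
      sum (p u) + sum (λ d → ⟦ at v c′ u d ⟧)   ≡⟨ cong (sum (p u) +_) (sum-at v c′ u) ⟩
      sum (p u) + ⟦ does (u ≟ v) ⟧              ∎
      where open ≡-Reasoning

  ends-replace : ∀ {L} xs {ys v w c c′} → Pointwise Ends L (xs ++ (v , w , c′) ∷ ys) →
    Pointwise Ends L (xs ++ (w , v , c) ∷ ys)
  ends-replace []       (inj₁ e ∷ es) = inj₂ e ∷ es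
  ends-replace []       (inj₂ e ∷ es) = inj₁ e ∷ es
  ends-replace (x ∷ xs) (e ∷ es)      = e ∷ ends-replace xs es

  -- Moving a pebble along a path

  module _ (ℓ : ℕ) where

    -- One pebble has gone from w to x. Only its effect on the totals is recorded, because its
    -- colour may change on the way.
    record Shifted (x w : Fin N) (s s′ : PState N k) : Set where
      field
        moves     : Star (Move ℓ) s s′
        canonical : Canonical s′
        same-ends : ∀ {L} → Pointwise Ends L (edges s) → Pointwise Ends L (edges s′)
        totals    : ∀ u → tot (peb s′) u + ⟦ does (u ≟ w) ⟧ ≡ tot (peb s) u + ⟦ does (u ≟ x) ⟧

    open Shifted

    shifted-refl : ∀ {x s} → Canonical s → Shifted x x s s
    shifted-refl can = record { moves = ε ; canonical = can ; same-ends = id ; totals = λ _ → refl }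

    shifted-trans : ∀ {x y z s s′ s″} → Shifted y z s s′ → Shifted x y s′ s″ → Shifted x z s s″
    shifted-trans {x} {y} {z} {s} {s′} {s″} A B = record
      { moves     = moves A ◅◅ moves B
      ; canonical = canonical B
      ; same-ends = same-ends B ∘ same-ends A
      ; totals    = λ u → +-cancelʳ-≡ ⟦ does (u ≟ y) ⟧ _ _ (begin
          t″ u + δ z u + δ y u  ≡⟨ xy∙z≈xz∙y (t″ u) _ _ ⟩
          t″ u + δ y u + δ z u  ≡⟨ cong (_+ δ z u) (totals B u) ⟩
          t′ u + δ x u + δ z u  ≡⟨ xy∙z≈xz∙y (t′ u) _ _ ⟩
          t′ u + δ z u + δ x u  ≡⟨ cong (_+ δ x u) (totals A u) ⟩
          t u + δ y u + δ x u   ≡⟨ xy∙z≈xz∙y (t u) _ _ ⟩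
          t u + δ x u + δ y u   ∎)
      }
      where
      open ≡-Reasoning
      t  = tot (peb s)
      t′ = tot (peb s′)
      t″ = tot (peb s″)
      δ = λ (v u : Fin N) → ⟦ does (u ≟ v) ⟧

    -- The last two components trace edges across the slide: forwards to carry over the rest of a
    -- path, backwards to control which vertices lead to the pebble.
    slide : ∀ {s v w c c′} → Canonical s → 1 ≤ peb s w c → (v , w , c′) ∈ edges s →
      c′ ≡ c ⊎ ¬ Leads (edges s) c v w →
      ∃ λ s′ → Shifted v w s s′ × 1 ≤ peb s′ v c′ ×
        (∀ {z} → z ∈ edges s  → z ≡ (v , w , c′) ⊎ z ∈ edges s′) ×
        (∀ {z} → z ∈ edges s′ → z ≡ (w , v , c) ⊎ z ∈ edges s)
    slide {pstate es p} {v} {w} {c} {c′} can h e∈ side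
      with p w c in eq | h
    ... | suc a | _ with xs , ys , refl ← ∈-∃++ e∈ =
      _ , record { moves     = pebble-slide xs ys v w c c′ a eq ◅ ε
                 ; canonical = canonical′ can side
                 ; same-ends = ends-replace xs
                 ; totals    = tot′ }
        , new-pebble , kept , ∈-replace xs
      where open Slide xs ys p v w c c′ a eq

    -- Passing a pebble back along edges of its own colour only re-roots a tree.
    reroot : ∀ d {s x w c} → Canonical s → 1 ≤ peb s w c → Within (Mono (edges s) c) d x w →
      ∃ λ s′ → Shifted x w s s′ × 1 ≤ peb s′ x c ×
        (∀ {a b d} → ¬ Leads (edges s) c a w → (a , b , d) ∈ edges s → (a , b , d) ∈ edges s′) ×
        (∀ {a} → Leads (edges s′) c a x → Leads (edges s) c a w)
    reroot d can h path with unsnoc path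
    ... | inj₁ refl = _ , shifted-refl can , h , (λ _ e → e) , id
    ... | inj₂ (d′ , u , refl , path′ , e)
      with s₁ , sh₁ , h₁ , old₁ , new₁ ← slide can h e (inj₁ refl)
      with s₂ , sh₂ , h₂ , keep₂ , back₂ ←
             reroot d′ (canonical sh₁) h₁
               (truncate (λ r → [ (λ { refl → inj₁ refl }) , inj₂ ]′ (old₁ r)) path′)
      = s₂ , shifted-trans sh₁ sh₂ , h₂
      -- Slid edges start inside the tree of w, so edges leaving vertices outside it survive.
      , (λ ¬l z → keep₂ (¬l ∘ pull) ([ (λ { refl → contradiction (e ◅ ε) ¬l }) , id ]′ (old₁ z)))
      , pull ∘ back₂
      where
      -- The only new edge leaves w: a walk to u that would use it has reached w already, and any
      -- other is continued from u to w by `e`.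
      pull : ∀ {a} → Leads (edges s₁) _ a u → Leads _ _ a _
      pull ε = e ◅ ε
      pull (r ◅ q) with new₁ r
      ... | inj₁ refl = ε
      ... | inj₂ r′   = r′ ◅ pull q

    -- The tails avoid the tree of w in colour c. Hence re-rooting that tree leaves these edges
    -- alone, and the last of them meets the side condition of `slide`.
    Outside : PState N k → Fin k → Fin N → Fin N → Fin N → Set
    Outside s c w a b = ¬ Leads (edges s) c a w × Link (edges s) a b

    first-leading : ∀ {s w c} → Canonical s → 1 ≤ peb s w c → ∀ {d x} → Within (Link (edges s)) d x w →
      ∃ λ y → Leads (edges s) c y w × Within (Outside s c w) d x y
    first-leading can h [] = _ , ε , []
    first-leading can h {x = x} (r ∷ p) with leads? can h x
    ... | yes q = x , q , []
    ... | no ¬q = let y , q , p′ = first-leading can h p in y , q , (¬q , r) ∷ p′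

    -- The pebble is first re-rooted to the first vertex of the path lying in its tree, so that
    -- the last edge of what remains of the path can be slid without closing a cycle.
    move-pebble : ∀ d {s x w c} → Canonical s → 1 ≤ peb s w c → Within (Link (edges s)) d x w →
      ∃ λ s′ → Shifted x w s s′
    move-pebble d {s} {x} {w} {c} can h path
      with y , q , path₁ ← first-leading can h path
      with d₁ , q₁ ← within q
      with s₁ , sh₁ , h₁ , keep₁ , back₁ ← reroot d₁ can h q₁
      -- Re-rooting adds no vertex to the tree (`back₁`) and keeps the edges leaving other vertices
      -- (`keep₁`), so the path is still outside.
      with unsnoc (mapWithin {R′ = Outside s₁ c y}
                     (λ (¬l , c′ , e) → (λ l → ¬l (back₁ l)) , c′ , keep₁ ¬l e) path₁)
    ... | inj₁ refl = s₁ , sh₁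
    ... | inj₂ (d′ , v , refl , path₂ , ¬l , c′ , e)
      with s₂ , sh₂ , h₂ , old₂ , _ ← slide (canonical sh₁) h₁ e (inj₂ ¬l)
      -- The pebble is now on v in colour c′, and the rest of the path has a smaller bound.
      with s₃ , sh₃ ← move-pebble d′ (canonical sh₂) h₂
             (truncate (λ (_ , c″ , r) → [ (λ { refl → inj₁ refl }) , (λ r′ → inj₂ (c″ , r′)) ]′ (old₂ r)) path₂)
      = s₃ , shifted-trans sh₁ (shifted-trans sh₂ sh₃)

  -- Gathering pebbles on the ends of a new edge

  Closed : List Arc → (Fin N → Bool) → Set
  Closed es P = ∀ a b c → (a , b , c) ∈ es → P a ≡ true → P b ≡ true

  -- Heads of leaving edges are added one by one. Each raises `size`, which is at most N, so the
  -- fuel suffices; Q records that every vertex added is reachable.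
  closure : ∀ fuel es (Q : Fin N → Set) → (∀ {a b} → Link es a b → Q a → Q b) →
    ∀ P → (∀ a → P a ≡ true → Q a) → N ≤ fuel + size P →
    ∃ λ P′ → (∀ a → P a ≡ true → P′ a ≡ true) × (∀ a → P′ a ≡ true → Q a) × Closed es P′
  closure fuel es Q stepQ P P⇒Q enough
    with any? (λ (a , b , _) → (P a ≟ᵇ true) ×-dec (P b ≟ᵇ false)) es
  ... | no none = P , (λ _ → id) , P⇒Q , closed
    where
    closed : Closed es P
    closed a b c e∈ Pa with P b in eq
    ... | true  = refl
    ... | false = contradiction (lose e∈ (Pa , eq)) none
  ... | yes some with (a , b , c) , e∈ , Pa , Pb ← find some = grow fuel enough
    where
    P⁺ = insert P b
    P⁺⇒Q : ∀ x → P⁺ x ≡ true → Q x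
    P⁺⇒Q x h with P x in eq | x ≟ b
    ... | true  | _        = P⇒Q x eq
    ... | false | yes refl = stepQ (c , e∈) (P⇒Q a Pa)
    P⊆P⁺ : ∀ x → P x ≡ true → P⁺ x ≡ true
    P⊆P⁺ x h rewrite h = refl
    grow : ∀ f → N ≤ f + size P → _
    grow zero    enough = contradiction (size≤N P⁺)
      (<⇒≱ (≤-<-trans enough (≤-reflexive (trans (+-comm 1 _) (sym (size-insert P Pb))))))
    grow (suc f) enough =
      let P′ , P⁺⊆P′ , P′⇒Q , closed = closure f es Q stepQ P⁺ P⁺⇒Q
            (≤-trans enough (≤-reflexive (trans (sym (+-suc f _))
              (cong (f +_) (trans (+-comm 1 _) (sym (size-insert P Pb)))))))
      in P′ , (λ x → P⁺⊆P′ x ∘ P⊆P⁺ x) , P′⇒Q , closed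

  tails : (Fin N → Bool) → List Arc → ℕ
  tails P []                 = 0
  tails P ((t , h , d) ∷ es) = ⟦ P t ⟧ + tails P es

  -- An arc whose tail lies in a closed set has its head there too, so spanned edges can be counted
  -- by their tails alone.
  closed⇒spanned≡tails : ∀ {P L es} → Pointwise Ends L es → Closed es P → spanned P L ≡ tails P es
  closed⇒spanned≡tails [] closed = refl
  closed⇒spanned≡tails {P} {es = (t , h , d) ∷ es} (e ∷ ends) closed =
    cong₂ _+_ (cong ⟦_⟧ (first-arc e)) (closed⇒spanned≡tails ends (λ a b c → closed a b c ∘ there))
    where
    th : P t ∧ P h ≡ P t
    th with P t in eq
    ... | true  = closed t h d (here refl) eq
    ... | false = refl
    first-arc : ∀ {x} → Ends x (t , h , d) → P (proj₁ x) ∧ P (proj₂ x) ≡ P t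
    first-arc (inj₁ refl) = th
    first-arc (inj₂ refl) = trans (∧-comm (P h) (P t)) th

  tails-sum : ∀ P es → sum (λ u → ⟦ P u ⟧ * sum (outdeg es u)) ≡ tails P es
  tails-sum P [] = sum-zero (λ u → trans (cong (⟦ P u ⟧ *_) (sum-zero {k} {λ _ → 0} (λ _ → refl))) (*-zeroʳ ⟦ P u ⟧))
  tails-sum P ((t , h , d) ∷ es) = begin
    sum (λ u → ⟦ P u ⟧ * sum (λ c → ⟦ at t d u c ⟧ + outdeg es u c))
      ≡⟨ sum-cong-≗ pointwise ⟩
    sum (λ u → ⟦ P u ⟧ * ⟦ does (u ≟ t) ⟧ + ⟦ P u ⟧ * sum (outdeg es u))
      ≡⟨ ∑-distrib-+ (λ u → ⟦ P u ⟧ * ⟦ does (u ≟ t) ⟧) _ ⟩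
    sum (λ u → ⟦ P u ⟧ * ⟦ does (u ≟ t) ⟧) + sum (λ u → ⟦ P u ⟧ * sum (outdeg es u))
      ≡⟨ cong₂ _+_ (sum-pick (λ u → ⟦ P u ⟧) t) (tails-sum P es) ⟩
    ⟦ P t ⟧ + tails P es ∎
    where
    open ≡-Reasoning
    pointwise : ∀ u → ⟦ P u ⟧ * sum (λ c → ⟦ at t d u c ⟧ + outdeg es u c) ≡
                      ⟦ P u ⟧ * ⟦ does (u ≟ t) ⟧ + ⟦ P u ⟧ * sum (outdeg es u)
    pointwise u = trans
      (cong (⟦ P u ⟧ *_) (trans (∑-distrib-+ (λ c → ⟦ at t d u c ⟧) _) (cong (_+ sum (outdeg es u)) (sum-at t d u))))
      (*-distribˡ-+ ⟦ P u ⟧ _ _)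

  -- Every vertex of P owns k tokens, each lying on the vertex or on an edge leaving it.
  token-count : ∀ {s} → Canonical s → ∀ P →
    sum (λ u → ⟦ P u ⟧ * tot (peb s) u) + tails P (edges s) ≡ k * size P
  token-count {s} can P = begin
    sum (λ u → ⟦ P u ⟧ * tot (peb s) u) + tails P (edges s)
      ≡⟨ cong (sum (λ u → ⟦ P u ⟧ * tot (peb s) u) +_) (tails-sum P (edges s)) ⟨
    sum (λ u → ⟦ P u ⟧ * tot (peb s) u) + sum (λ u → ⟦ P u ⟧ * sum (outdeg (edges s) u))
      ≡⟨ ∑-distrib-+ (λ u → ⟦ P u ⟧ * tot (peb s) u) _ ⟨
    sum (λ u → ⟦ P u ⟧ * tot (peb s) u + ⟦ P u ⟧ * sum (outdeg (edges s) u))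
      ≡⟨ sum-cong-≗ pointwise ⟩
    sum (λ u → k * ⟦ P u ⟧)
      ≡⟨ *-distribˡ-sum k (λ u → ⟦ P u ⟧) ⟨
    k * size P ∎
    where
    open ≡-Reasoning
    pointwise : ∀ u → ⟦ P u ⟧ * tot (peb s) u + ⟦ P u ⟧ * sum (outdeg (edges s) u) ≡ k * ⟦ P u ⟧
    pointwise u = begin
      ⟦ P u ⟧ * tot (peb s) u + ⟦ P u ⟧ * sum (outdeg (edges s) u)
        ≡⟨ *-distribˡ-+ ⟦ P u ⟧ _ _ ⟨
      ⟦ P u ⟧ * (tot (peb s) u + sum (outdeg (edges s) u))
        ≡⟨ cong (⟦ P u ⟧ *_) (∑-distrib-+ (peb s u) _) ⟨
      ⟦ P u ⟧ * sum (λ c → peb s u c + outdeg (edges s) u c)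
        ≡⟨ cong (⟦ P u ⟧ *_) (trans (sum-cong-≗ (balanced can u)) (trans (sum-const k 1) (*-identityʳ k))) ⟩
      ⟦ P u ⟧ * k
        ≡⟨ *-comm ⟦ P u ⟧ k ⟩
      k * ⟦ P u ⟧ ∎

  module _ (ℓ : ℕ) where

    -- Sparsity for the edges induced by a vertex set; the list form matches their insertion one at
    -- a time.
    SparseList : List (Fin N × Fin N) → Set
    SparseList L = ∀ P → 1 ≤ spanned P L → spanned P L + ℓ ≤ k * size P

    sparse-tail : ∀ {e L} → SparseList (e ∷ L) → SparseList L
    sparse-tail {e} {L} sp P h = ≤-trans (+-monoˡ-≤ ℓ (m≤n+m (spanned P L) _)) (sp P (≤-trans h (m≤n+m _ _)))

    -- Otherwise the set reachable from {v , w} would span an edge too many once vw is added.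
    find-pebble : ∀ {L s v w} → SparseList ((v , w) ∷ L) → v ≢ w → Canonical s → Pointwise Ends L (edges s) →
      tot (peb s) v + tot (peb s) w ≤ ℓ →
      ∃₂ λ x c → x ≢ v × x ≢ w × 1 ≤ peb s x c × (Star (Link (edges s)) v x ⊎ Star (Link (edges s)) w x)
    find-pebble {L} {s} {v} {w} sp v≢w can ends few = search
      (Fin.any? (λ x → (P x ≟ᵇ true) ×-dec ¬? (x ≟ v) ×-dec ¬? (x ≟ w) ×-dec (1 ≤? tot (peb s) x)))
      where
      Q : Fin N → Set
      Q x = Star (Link (edges s)) v x ⊎ Star (Link (edges s)) w x

      P₀ : Fin N → Bool
      P₀ = insert (λ x → does (x ≟ v)) w

      P₀⇒Q : ∀ a → P₀ a ≡ true → Q a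
      P₀⇒Q a h with a ≟ v | a ≟ w
      ... | yes refl | _        = inj₁ ε
      ... | no _     | yes refl = inj₂ ε

      stepQ : ∀ {a b} → Link (edges s) a b → Q a → Q b
      stepQ l (inj₁ q) = inj₁ (q ◅◅ l ◅ ε)
      stepQ l (inj₂ q) = inj₂ (q ◅◅ l ◅ ε)

      reached = closure N (edges s) Q stepQ P₀ P₀⇒Q (m≤m+n N _)
      P = proj₁ reached

      Pv : P v ≡ true
      Pv = proj₁ (proj₂ reached) v (cong (_∨ does (v ≟ w)) (dec-true (v ≟ v) refl))

      Pw : P w ≡ true
      Pw = proj₁ (proj₂ reached) w
        (trans (cong (does (w ≟ v) ∨_) (dec-true (w ≟ w) refl)) (∨-zeroʳ (does (w ≟ v))))

      Hit : Fin N → Set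
      Hit x = P x ≡ true × x ≢ v × x ≢ w × 1 ≤ tot (peb s) x

      search : Dec (∃ Hit) → ∃₂ λ x c → x ≢ v × x ≢ w × 1 ≤ peb s x c × Q x
      search (yes (x , Px , x≢v , x≢w , h)) =
        let c , hc = sum-positive (peb s x) h
        in x , c , x≢v , x≢w , hc , proj₁ (proj₂ (proj₂ reached)) x Px
      search (no none) = contradiction bound (<-irrefl refl)
        where
        t = tot (peb s)
        δ = λ (v u : Fin N) → ⟦ does (u ≟ v) ⟧

        -- As the search has failed, all pebbles on P lie on v or w, at most ℓ in total.
        pointwise : ∀ u → ⟦ P u ⟧ * t u ≤ t u * δ v u + t u * δ w u
        pointwise u with u ≟ v
        ... | yes refl = ≤-trans (*-monoˡ-≤ (t u) (⟦⟧≤1 (P u)))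
                                 (≤-trans (≤-reflexive (*-comm 1 (t u))) (m≤m+n _ _))
        ... | no u≢v with u ≟ w
        ...   | yes refl = ≤-trans (*-monoˡ-≤ (t u) (⟦⟧≤1 (P u)))
                                   (≤-trans (≤-reflexive (*-comm 1 (t u))) (m≤n+m _ _))
        ...   | no u≢w with P u in Pu
        ...     | false = z≤n
        ...     | true  with t u in tu
        ...       | zero  = z≤n
        ...       | suc _ = contradiction (u , Pu , u≢v , u≢w , subst (1 ≤_) (sym tu) (s≤s z≤n)) none

        pebbles≤ℓ : sum (λ u → ⟦ P u ⟧ * t u) ≤ ℓ
        pebbles≤ℓ = ≤-trans (sum-mono pointwise) (≤-trans (≤-reflexive
          (trans (∑-distrib-+ (λ u → t u * δ v u) _) (cong₂ _+_ (sum-pick t v) (sum-pick t w)))) few)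

        spanned-new : spanned P ((v , w) ∷ L) ≡ suc (spanned P L)
        spanned-new = cong (λ b → ⟦ b ⟧ + spanned P L) (cong₂ _∧_ Pv Pw)

        bound : spanned P L + ℓ < spanned P L + ℓ
        bound = begin
          suc (spanned P L) + ℓ                             ≡⟨ cong (_+ ℓ) spanned-new ⟨
          spanned P ((v , w) ∷ L) + ℓ                       ≤⟨ sp P (subst (1 ≤_) (sym spanned-new) (s≤s z≤n)) ⟩
          k * size P                                        ≡⟨ token-count can P ⟨
          sum (λ u → ⟦ P u ⟧ * t u) + tails P (edges s)     ≤⟨ +-monoˡ-≤ _ pebbles≤ℓ ⟩
          ℓ + tails P (edges s)                             ≡⟨ cong (ℓ +_) (closed⇒spanned≡tails ends (proj₂ (proj₂ (proj₂ reached)))) ⟨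
          ℓ + spanned P L                                   ≡⟨ +-comm ℓ _ ⟩
          spanned P L + ℓ                                   ∎
          where open ≤-Reasoning

    record Position (L : List (Fin N × Fin N)) (s s′ : PState N k) : Set where
      field
        moves     : Star (Move ℓ) s s′
        canonical : Canonical s′
        ends      : Pointwise Ends L (edges s′)

    open Position

    shifted-total : ∀ {x y s s′} → Shifted ℓ y x s s′ → ∀ {u} → u ≢ x →
      tot (peb s′) u ≡ tot (peb s) u + ⟦ does (u ≟ y) ⟧
    shifted-total {x} {y} sh {u} u≢x = trans (sym (+-identityʳ _))
      (trans (cong (λ b → _ + ⟦ b ⟧) (sym (dec-false (u ≟ x) u≢x))) (Shifted.totals sh u))

    -- The pebble comes from outside {v , w}, so nothing is lost on the pair.
    one-more : ∀ {L s v w} → SparseList ((v , w) ∷ L) → v ≢ w → Canonical s → Pointwise Ends L (edges s) →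
      tot (peb s) v + tot (peb s) w ≤ ℓ →
      ∃ λ s′ → Position L s s′ × tot (peb s′) v + tot (peb s′) w ≡ suc (tot (peb s) v + tot (peb s) w)
    one-more {L} {s} {v} {w} sp v≢w can ends few
      with x , c , x≢v , x≢w , h , reach ← find-pebble sp v≢w can ends few = move reach
      where
      position : ∀ {y s′} → Shifted ℓ y x s s′ → Position L s s′
      position sh = record { moves = Shifted.moves sh ; canonical = Shifted.canonical sh ; ends = Shifted.same-ends sh ends }

      t = tot (peb s)

      move : _ ⊎ _ → _
      move (inj₁ q) =
        let d , q′  = within q
            s′ , sh = move-pebble ℓ d can h q′
        in s′ , position sh , trans (cong₂ _+_ (shifted-total sh (x≢v ∘ sym)) (shifted-total sh (x≢w ∘ sym)))
             (trans (cong₂ (λ a b → t v + ⟦ a ⟧ + (t w + ⟦ b ⟧)) (dec-true (v ≟ v) refl) (dec-false (w ≟ v) (v≢w ∘ sym)))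
               (trans (interchange (t v) 1 (t w) 0) (+-comm (t v + t w) 1)))
      move (inj₂ q) =
        let d , q′  = within q
            s′ , sh = move-pebble ℓ d can h q′
        in s′ , position sh , trans (cong₂ _+_ (shifted-total sh (x≢v ∘ sym)) (shifted-total sh (x≢w ∘ sym)))
             (trans (cong₂ (λ a b → t v + ⟦ a ⟧ + (t w + ⟦ b ⟧)) (dec-false (v ≟ w) v≢w) (dec-true (w ≟ w) refl))
               (trans (interchange (t v) 0 (t w) 1) (+-comm (t v + t w) 1)))

    -- The fuel bounds the number of pebbles still missing from ℓ + 1.
    gather : ∀ fuel {L s v w} → SparseList ((v , w) ∷ L) → v ≢ w → Canonical s → Pointwise Ends L (edges s) →
      suc ℓ ≤ fuel + (tot (peb s) v + tot (peb s) w) →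
      ∃ λ s′ → Position L s s′ × suc ℓ ≤ tot (peb s′) v + tot (peb s′) w
    gather fuel {L} {s} {v} {w} sp v≢w can ends enough
      with suc ℓ ≤? tot (peb s) v + tot (peb s) w
    ... | yes h = s , record { moves = ε ; canonical = can ; ends = ends } , h
    gather zero sp v≢w can ends enough | no ¬h = contradiction enough ¬h
    gather (suc fuel) sp v≢w can en enough | no ¬h
      with s₁ , pos₁ , grown ← one-more sp v≢w can en (s≤s⁻¹ (≰⇒> ¬h))
      with s₂ , pos₂ , h ← gather fuel sp v≢w (canonical pos₁) (ends pos₁)
             (≤-trans enough (≤-reflexive (trans (sym (+-suc fuel _)) (cong (fuel +_) (sym grown)))))
      = s₂ , record { moves = moves pos₁ ◅◅ moves pos₂ ; canonical = canonical pos₂ ; ends = ends pos₂ } , h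

    -- Both ends being roots of distinct trees of colour c, the new edge joins two trees.
    add-canonical : ∀ {es p v w c a} → Canonical (pstate es p) → v ≢ w → p v c ≡ suc a → 1 ≤ p w c →
      Canonical (pstate ((v , w , c) ∷ es) (setPeb p v c a))
    add-canonical {es} {p} {v} {w} {c} {a} can v≢w pv pw = record { balanced = bal ; rooted = root }
      where
      p′ = setPeb p v c a
      es′ = (v , w , c) ∷ es

      bal : ∀ u d → p′ u d + outdeg es′ u d ≡ 1
      bal u d = trans (sym (+-assoc (p′ u d) _ _))
        (trans (cong (_+ outdeg es u d) (pick-up p pv u d)) (balanced can u d))

      old : ∀ {r d} → ¬ (r ≡ v × d ≡ c) → 1 ≤ p r d → 1 ≤ p′ r d
      old {r} {d} ne h = subst (1 ≤_)
        (trans (sym (pick-up p pv r d)) (trans (cong (λ b → p′ r d + ⟦ b ⟧) (at-false ne)) (+-identityʳ _))) h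

      root : ∀ u d → ∃ λ r → 1 ≤ p′ r d × Leads es′ d u r
      root u d with r , h , q ← rooted can u d with (r ≟ v) ×-dec (d ≟ c)
      ... | no ne             = r , old ne h , Star.map there q
      ... | yes (refl , refl) = w , old (λ (w≡v , _) → v≢w (sym w≡v)) pw , Star.map there q ◅◅ here refl ◅ ε

    total≡tot : ∀ p v → total {N} {k} p v ≡ tot p v
    total≡tot p v = trans (cong ListAction.sum (map-tabulate id (p v))) (sum-tabulate (p v))
      where
      sum-tabulate : ∀ {n} (f : Fin n → ℕ) → ListAction.sum (List.tabulate f) ≡ sum f
      sum-tabulate {zero}  f = refl
      sum-tabulate {suc n} f = cong (f zero +_) (sum-tabulate (f ∘ suc))

    -- Pigeonhole: without a common colour each of the k colours contributes at most one pebble to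
    -- the pair, which leaves at most k ≤ ℓ.
    common-colour : ∀ {s v w} → Canonical s → k ≤ ℓ → suc ℓ ≤ tot (peb s) v + tot (peb s) w →
      ∃ λ c → 1 ≤ peb s v c × 1 ≤ peb s w c
    common-colour {s} {v} {w} can k≤ℓ many
      with Fin.any? (λ c → (1 ≤? peb s v c) ×-dec (1 ≤? peb s w c))
    ... | yes found = found
    ... | no none   = contradiction (≤-trans (s≤s k≤ℓ) (≤-trans many few)) (<-irrefl refl)
      where
      pointwise : ∀ c → peb s v c + peb s w c ≤ 1
      pointwise c with 1 ≤? peb s v c
      ... | no ¬h = subst (λ a → a + peb s w c ≤ 1) (sym (n<1⇒n≡0 (≰⇒> ¬h))) (peb≤1 can w c)
      ... | yes h with 1 ≤? peb s w c
      ...   | yes h′ = contradiction (c , h , h′) none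
      ...   | no ¬h′ = subst (λ a → peb s v c + a ≤ 1) (sym (n<1⇒n≡0 (≰⇒> ¬h′)))
                         (subst (_≤ 1) (sym (+-identityʳ _)) (peb≤1 can v c))
      few : tot (peb s) v + tot (peb s) w ≤ k
      few = ≤-trans (≤-reflexive (sym (∑-distrib-+ (peb s v) (peb s w))))
        (≤-trans (sum-mono pointwise) (≤-reflexive (trans (sum-const k 1) (*-identityʳ k))))

    -- A loop at v would force 1 + ℓ ≤ k on the subgraph with the single vertex v, against k ≤ ℓ.
    sparse⇒loopless : ∀ {v w L} → k ≤ ℓ → SparseList ((v , w) ∷ L) → v ≢ w
    sparse⇒loopless {v} {L = L} k≤ℓ sp refl = contradiction (≤-trans (+-monoˡ-≤ ℓ one) (≤-trans (sp P one)
        (≤-trans (≤-reflexive (trans (cong (k *_) (sum-indicator v)) (*-identityʳ k))) k≤ℓ))) (<-irrefl refl)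
      where
      P = λ (x : Fin N) → does (x ≟ v)
      one : 1 ≤ spanned P ((v , v) ∷ L)
      one = subst (λ b → 1 ≤ ⟦ b ∧ b ⟧ + spanned P L) (sym (dec-true (v ≟ v) refl)) (s≤s z≤n)

    play : k ≤ ℓ → ∀ L → SparseList L → ∃ (Position L initial)
    play k≤ℓ [] sp = initial , record
      { moves     = ε
      ; canonical = record { balanced = λ _ _ → refl ; rooted = λ v _ → v , s≤s z≤n , ε }
      ; ends      = []
      }
    play k≤ℓ ((v , w) ∷ L) sp
      with s₁ , pos₁ ← play k≤ℓ L (sparse-tail {v , w} {L} sp)
      with v≢w ← sparse⇒loopless {v} {w} {L} k≤ℓ sp
      -- Fuel ℓ + 1 covers even a pair that carries no pebble at all.
      with pstate es p , pos₂ , many ← gather (suc ℓ) sp v≢w (canonical pos₁) (ends pos₁) (m≤m+n (suc ℓ) _)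
      with c , hv , hw ← common-colour (canonical pos₂) k≤ℓ many
      with p v c in eq | hv
    ... | suc a | _ = _ , record
      { moves     = moves pos₁ ◅◅ moves pos₂ ◅◅ add-edge v w c a eq pair ◅ ε
      ; canonical = add-canonical (canonical pos₂) v≢w eq hw
      ; ends      = inj₁ refl ∷ ends pos₂
      }
      where
      pair : suc ℓ ≤ onPair p v w
      pair rewrite dec-false (v ≟ w) v≢w | total≡tot p v | total≡tot p w = many

-- From sparse graphs to canonical states

∈ˢ⇒lookup : ∀ {n} {S : Subset n} {x} → x ∈ˢ S → lookup S x ≡ true
∈ˢ⇒lookup = []=⇒lookup

lookup⇒∈ˢ : ∀ {n} {S : Subset n} {x} → lookup S x ≡ true → x ∈ˢ S
lookup⇒∈ˢ {S = S} {x} = lookup⇒[]= x S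

∈ˢ-tabulate⁺ : ∀ {n} {f : Fin n → Bool} {x} → f x ≡ true → x ∈ˢ tabulate f
∈ˢ-tabulate⁺ {f = f} {x} h = lookup⇒∈ˢ (trans (lookup∘tabulate f x) h)

∈ˢ-tabulate⁻ : ∀ {n} {f : Fin n → Bool} {x} → x ∈ˢ tabulate f → f x ≡ true
∈ˢ-tabulate⁻ {f = f} {x} h = trans (sym (lookup∘tabulate f x)) (∈ˢ⇒lookup h)

does⇒ : ∀ {n} {x y : Fin n} → does (x ≟ y) ≡ true → x ≡ y
does⇒ {x = x} {y} h with x ≟ y
... | yes eq = eq

∧-true : ∀ {a b} → a ∧ b ≡ true → a ≡ true × b ≡ true
∧-true {true} {true} _ = refl , refl

∧-intro : ∀ {a b} → a ≡ true → b ≡ true → a ∧ b ≡ true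
∧-intro refl refl = refl

nonempty⇒1≤∣∣ : ∀ {n} {S : Subset n} → Nonempty S → 1 ≤ ∣ S ∣
nonempty⇒1≤∣∣ {S = S} (x , x∈S) = subst (1 ≤_) (sym (∣∣-sum S))
  (≤-trans (≤-reflexive (cong ⟦_⟧ (sym (∈ˢ⇒lookup x∈S)))) (term≤sum (λ i → ⟦ lookup S i ⟧) x))

spanned-tabulate : ∀ {N m} (P : Fin N → Bool) (f : Fin m → Fin N × Fin N) →
  spanned P (List.tabulate f) ≡ sum (λ e → ⟦ P (proj₁ (f e)) ∧ P (proj₂ (f e)) ⟧)
spanned-tabulate {m = zero}  P f = refl
spanned-tabulate {m = suc m} P f = cong (_ +_) (spanned-tabulate P (f ∘ suc))

-- Slides replace edges in place and new edges go in front, so the final list still follows the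
-- numbering of the edges of the graph; this reads off the arc of each edge.
pointwise-tabulate : ∀ {A B : Set} {R : A → B → Set} {m} (f : Fin m → A) {ys} →
  Pointwise R (List.tabulate f) ys → Σ (Fin m → B) λ g → ys ≡ List.tabulate g × (∀ i → R (f i) (g i))
pointwise-tabulate {m = zero}  f [] = (λ ()) , refl , λ ()
pointwise-tabulate {m = suc m} f (_∷_ {y = y} r rs) with g , refl , h ← pointwise-tabulate (f ∘ suc) rs =
  (λ { zero → y ; (suc i) → g i }) , refl , λ { zero → r ; (suc i) → h i }

lookupL-tabulate : ∀ {A : Set} {m} (g : Fin m → A) i →
  lookupL (List.tabulate g) (cast (sym (length-tabulate g)) i) ≡ g i
lookupL-tabulate g zero    = refl
lookupL-tabulate g (suc i) = lookupL-tabulate (g ∘ suc) i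

tabulate-⤖ : ∀ {A : Set} {m} (g : Fin m → A) → Fin m ⤖ Fin (List.length (List.tabulate g))
tabulate-⤖ g = ↔⇒⤖ (mk↔ₛ′ (cast (sym eq)) (cast eq) (Fin.cast-involutive (sym eq) eq) (Fin.cast-involutive eq (sym eq)))
  where eq = length-tabulate g

module _ (G : Graph) (k ℓ : ℕ) where

  -- Arcs are indexed by the edges of G, so that trees can be read off as edge sets and the
  -- bijection of a pebble-game graph is immediate.
  record Orientation : Set where
    field
      arc       : Fin (m G) → Arc {n G} {k}
      pebbles   : Fin (n G) → Fin k → ℕ
      reachable : Reachable ℓ (pstate (List.tabulate arc) pebbles)
      canonical : Canonical (pstate (List.tabulate arc) pebbles)
      joins     : ∀ e → Joins G e (proj₁ (arc e)) (proj₁ (proj₂ (arc e)))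

  sparse⇒sparse-list : Sparse G k ℓ → SparseList {n G} {k} ℓ (List.tabulate (ends G))
  sparse⇒sparse-list sp P h = subst₂ (λ a b → a + ℓ ≤ k * b) count (∣tabulate∣ P)
    (sp (tabulate P) (tabulate inside) sub (subst (1 ≤_) (sym count) h))
    where
    inside = λ e → P (proj₁ (ends G e)) ∧ P (proj₂ (ends G e))
    count : ∣ tabulate inside ∣ ≡ spanned P (List.tabulate (ends G))
    count = trans (∣tabulate∣ inside) (sym (spanned-tabulate P (ends G)))
    sub : IsSubgraph G (tabulate P) (tabulate inside)
    sub e e∈ = let a , b = ∧-true (∈ˢ-tabulate⁻ {f = inside} e∈) in ∈ˢ-tabulate⁺ a , ∈ˢ-tabulate⁺ b

  sparse⇒orientation : k ≤ ℓ → Sparse G k ℓ → Orientation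
  sparse⇒orientation k≤ℓ sp
    with pstate es p , pos ← play ℓ k≤ℓ (List.tabulate (ends G)) (sparse⇒sparse-list sp)
    with g , refl , js ← pointwise-tabulate (ends G) (Position.ends pos)
    = record { arc = g ; pebbles = p ; reachable = Position.moves pos ; canonical = Position.canonical pos ; joins = js }

  orientation⇒game : Orientation → PebbleGameGraph k ℓ G
  orientation⇒game o = _ , reachable , tabulate-⤖ arc , λ e →
    subst (λ a → Joins G e (proj₁ a) (proj₁ (proj₂ a))) (sym (lookupL-tabulate arc e)) (joins e)
    where open Orientation o

-- The rooted forests of a canonical state

module _ (G : Graph) where

  joins-sym : ∀ {e x y} → Joins G e x y → Joins G e y x
  joins-sym = swap

  joins-cases : ∀ {e x y x′ y′} → Joins G e x y → Joins G e x′ y′ → (x ≡ x′ × y ≡ y′) ⊎ (x ≡ y′ × y ≡ x′)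
  joins-cases (inj₁ p) (inj₁ q) with refl ← trans (sym p) q = inj₁ (refl , refl)
  joins-cases (inj₁ p) (inj₂ q) with refl ← trans (sym p) q = inj₂ (refl , refl)
  joins-cases (inj₂ p) (inj₁ q) with refl ← trans (sym p) q = inj₂ (refl , refl)
  joins-cases (inj₂ p) (inj₂ q) with refl ← trans (sym p) q = inj₁ (refl , refl)

  reach-trans : ∀ {E x y z} → Reach G E x y → Reach G E y z → Reach G E x z
  reach-trans p here           = p
  reach-trans p (step e q h j) = step e (reach-trans p q) h j

  reach-sym : ∀ {E x y} → Reach G E x y → Reach G E y x
  reach-sym here           = here
  reach-sym (step e p h j) = reach-trans (step e here h (joins-sym j)) (reach-sym p)

argmax : ∀ {r} (f : Fin (suc r) → ℕ) → ∃ λ i → ∀ j → f j ≤ f i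
argmax {zero}  f = zero , λ { zero → ≤-refl }
argmax {suc r} f with i , h ← argmax (f ∘ suc) with ≤-total (f zero) (f (suc i))
... | inj₁ le = suc i , λ { zero → le ; (suc j) → h j }
... | inj₂ ge = zero , λ { zero → ≤-refl ; (suc j) → ≤-trans (h j) ge }

module _ {G : Graph} {E : Fin (m G) → Set} (C : Cycle G E) where
  open Cycle C

  Incident : Fin (suc r) → Fin (suc r) → Set
  Incident i a = ∃ λ u → Joins G (es a) (vs i) (vs u)

  forward : ∀ i → Incident i i
  forward i with view i
  ... | ‵fromℕ         = zero , close
  ... | ‵inj₁ {i = j} _ = suc j , joins j

  -- The edges before and after a cycle vertex coincide only if the cycle is a loop.
  backward : ∀ i → ∃ λ a → Incident i a × (a ≡ i → r ≡ 0)
  backward zero    = fromℕ r , (fromℕ r , joins-sym G {es (fromℕ r)} close) , λ eq → trans (sym (Fin.toℕ-fromℕ r)) (cong toℕ eq)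
  backward (suc i) = inject₁ i , (inject₁ i , joins-sym G {es (inject₁ i)} (joins i))
    , λ eq → contradiction (trans (sym (Fin.toℕ-inject₁ i)) (cong toℕ eq)) (λ e → 1+n≢n (sym e))

steps : ∀ {A : Set} {R : A → A → Set} {x y} → Star R x y → ℕ
steps ε       = 0
steps (_ ◅ p) = suc (steps p)

positive : ℕ → Bool
positive zero    = false
positive (suc _) = true

1≤⇒positive : ∀ {a} → 1 ≤ a → positive a ≡ true
1≤⇒positive (s≤s _) = refl

positive⇒1≤ : ∀ {a} → positive a ≡ true → 1 ≤ a
positive⇒1≤ {suc a} _ = s≤s z≤n

≤1⇒⟦positive⟧ : ∀ {a} → a ≤ 1 → ⟦ positive a ⟧ ≡ a
≤1⇒⟦positive⟧ z≤n       = refl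
≤1⇒⟦positive⟧ (s≤s z≤n) = refl

module Forests (G : Graph) (k ℓ : ℕ) (o : Orientation G k ℓ) (count : HasTightCount G k ℓ) where

  open Orientation o renaming (joins to arc-joins)
  open Canonical canonical

  V = Fin (n G)
  M = Fin (m G)

  tail head : M → V
  tail e = proj₁ (arc e)
  head e = proj₁ (proj₂ (arc e))

  colour : M → Fin k
  colour e = proj₂ (proj₂ (arc e))

  arcs : List Arc
  arcs = List.tabulate arc

  arc∈ : ∀ e → (tail e , head e , colour e) ∈ arcs
  arc∈ e = ∈-tabulate⁺ e

  outdeg-tabulate : ∀ {m} (g : Fin m → Arc {n G} {k}) v c →
    outdeg (List.tabulate g) v c ≡ sum (λ e → ⟦ at (proj₁ (g e)) (proj₂ (proj₂ (g e))) v c ⟧)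
  outdeg-tabulate {zero}  g v c = refl
  outdeg-tabulate {suc m} g v c = cong (⟦ at (proj₁ (g zero)) (proj₂ (proj₂ (g zero))) v c ⟧ +_) (outdeg-tabulate (g ∘ suc) v c)

  -- For the indicator w of an edge set, the out-degree in that set; the constant `true` recovers
  -- `outdeg`.
  out : (M → Bool) → V → Fin k → ℕ
  out w v c = sum (λ e → ⟦ w e ∧ at (tail e) (colour e) v c ⟧)

  out-all≤1 : ∀ v c → out (λ _ → true) v c ≤ 1
  out-all≤1 v c = subst (_≤ 1) (outdeg-tabulate arc v c) (outdeg≤1 canonical v c)

  out≤1 : ∀ w v c → out w v c ≤ 1
  out≤1 w v c = ≤-trans (sum-mono pointwise) (out-all≤1 v c)
    where
    pointwise : ∀ e → ⟦ w e ∧ at (tail e) (colour e) v c ⟧ ≤ ⟦ at (tail e) (colour e) v c ⟧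
    pointwise e with w e
    ... | true  = ≤-refl
    ... | false = z≤n

  -- Each edge is counted once, at its tail and colour.
  sum₂-out : ∀ w → sum₂ (out w) ≡ sum (λ e → ⟦ w e ⟧)
  sum₂-out w = begin
    sum (λ v → sum (λ c → sum (λ e → f e v c)))  ≡⟨ sum-cong-≗ (λ v → ∑-comm (λ c e → f e v c)) ⟩
    sum (λ v → sum (λ e → sum (f e v)))          ≡⟨ ∑-comm (λ v e → sum (f e v)) ⟩
    sum (λ e → sum₂ (f e))                       ≡⟨ sum-cong-≗ each ⟩
    sum (λ e → ⟦ w e ⟧)                          ∎
    where
    open ≡-Reasoning
    f = λ e v c → ⟦ w e ∧ at (tail e) (colour e) v c ⟧
    each : ∀ e → sum₂ (f e) ≡ ⟦ w e ⟧
    each e with w e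
    ... | true  = sum₂-at (tail e) (colour e)
    ... | false = sum-zero {n G} (λ v → sum-zero {k} {λ _ → 0} (λ _ → refl))

  arc-unique : ∀ {e e′} → tail e ≡ tail e′ → colour e ≡ colour e′ → e ≡ e′
  arc-unique {e} {e′} t≡ c≡ with e ≟ e′
  ... | yes eq = eq
  ... | no neq = contradiction
    (≤-trans (two≤sum (λ e″ → ⟦ at (tail e″) (colour e″) (tail e) (colour e) ⟧) neq) (out-all≤1 (tail e) (colour e)))
    (subst₂ (λ a b → ¬ ⟦ a ⟧ + ⟦ b ⟧ ≤ 1) (sym (at-refl (tail e) (colour e)))
      (sym (trans (cong₂ (at (tail e′) (colour e′)) t≡ c≡) (at-refl (tail e′) (colour e′)))) λ { (s≤s ()) })

  -- There are kn tokens, one for each vertex and colour, and kn - ℓ of them lie on edges.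
  sum₂-pebbles : sum₂ pebbles ≡ ℓ
  sum₂-pebbles = +-cancelʳ-≡ (m G) _ _ (begin
    sum₂ pebbles + m G                                    ≡⟨ cong (sum₂ pebbles +_) (trans (sum₂-out (λ _ → true)) (trans (sum-const (m G) 1) (*-identityʳ _))) ⟨
    sum₂ pebbles + sum₂ (out (λ _ → true))                ≡⟨ sum₂-+ pebbles _ ⟨
    sum₂ (λ v c → pebbles v c + out (λ _ → true) v c)     ≡⟨ sum₂-cong (λ v c → trans (cong (pebbles v c +_) (sym (outdeg-tabulate arc v c))) (balanced v c)) ⟩
    sum₂ {n G} {k} (λ v c → 1)                            ≡⟨ sum-cong-≗ {n G} (λ _ → trans (sum-const k 1) (*-identityʳ k)) ⟩
    sum {n G} (λ v → k)                                   ≡⟨ trans (sum-const (n G) k) (*-comm (n G) k) ⟩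
    k * n G                                               ≡⟨ count ⟨
    m G + ℓ                                               ≡⟨ +-comm (m G) ℓ ⟩
    ℓ + m G                                               ∎)
    where open ≡-Reasoning

  root : V → Fin k → V
  root v c = proj₁ (rooted v c)

  root-pebble : ∀ v c → 1 ≤ pebbles (root v c) c
  root-pebble v c = proj₁ (proj₂ (rooted v c))

  to-root : ∀ v c → Leads arcs c v (root v c)
  to-root v c = proj₂ (proj₂ (rooted v c))

  leads⇒root≡ : ∀ {u v c} → Leads arcs c u v → root u c ≡ root v c
  leads⇒root≡ {u} {v} {c} p = root-unique canonical (root-pebble u c) (root-pebble v c) (to-root u c) (p ◅◅ to-root v c)

  root-arc : ∀ e → root (head e) (colour e) ≡ root (tail e) (colour e)
  root-arc e = sym (leads⇒root≡ (arc∈ e ◅ ε))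

  pebble⇒root≡ : ∀ {r c} → 1 ≤ pebbles r c → root r c ≡ r
  pebble⇒root≡ {r} {c} h = root-unique canonical (root-pebble r c) h (to-root r c) ε

  -- Makes `height` independent of the walks that `rooted` happens to supply, so that it drops by
  -- exactly one along each arc.
  steps-unique : ∀ {v r r′ c} → 1 ≤ pebbles r c → 1 ≤ pebbles r′ c →
    (p : Leads arcs c v r) (q : Leads arcs c v r′) → steps p ≡ steps q
  steps-unique h h′ ε       ε        = refl
  steps-unique h h′ ε       (e ◅ _)  = contradiction e (pebble⇒terminal canonical h)
  steps-unique h h′ (e ◅ _) ε        = contradiction e (pebble⇒terminal canonical h′)
  steps-unique h h′ (e ◅ p) (e′ ◅ q) with refl ← outdeg≤1⇒unique (outdeg≤1 canonical _ _) e e′ =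
    cong suc (steps-unique h h′ p q)

  height : V → Fin k → ℕ
  height v c = steps (to-root v c)

  height-arc : ∀ e → height (tail e) (colour e) ≡ suc (height (head e) (colour e))
  height-arc e = steps-unique (root-pebble _ _) (root-pebble _ _) (to-root (tail e) (colour e))
    (arc∈ e ◅ to-root (head e) (colour e))

  -- Both edges of the cycle at a vertex of maximal height would have to leave it.
  monochromatic⇒acyclic : ∀ {E c} → (∀ {e} → E e → colour e ≡ c) → ¬ Cycle G E
  monochromatic⇒acyclic {E} {c} mono C with i , max ← argmax (λ i → height (Cycle.vs C i) c) = impossible
    where
    open Cycle C

    leaves : ∀ {a} → Incident C i a → tail (es a) ≡ vs i
    leaves {a} (u , j) with refl ← mono (es-in a) with joins-cases G {es a} (arc-joins (es a)) j
    ... | inj₁ (t≡ , _)  = t≡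
    -- An edge entering `vs i` would come from a cycle vertex of greater height.
    ... | inj₂ (t≡ , h≡) = contradiction (max u)
      (<⇒≱ (≤-reflexive (trans (cong (λ x → suc (height x (colour (es a)))) (sym h≡))
        (trans (sym (height-arc (es a))) (cong (λ x → height x (colour (es a))) t≡)))))

    loopless : ∀ {e x} → Joins G e x x → ⊥
    loopless {e} j with joins-cases G {e} (arc-joins e) j
    ... | inj₁ (t≡ , h≡) = 1+n≢n (sym (trans (cong (λ x → height x (colour e)) (trans h≡ (sym t≡))) (height-arc e)))
    ... | inj₂ (t≡ , h≡) = 1+n≢n (sym (trans (cong (λ x → height x (colour e)) (trans h≡ (sym t≡))) (height-arc e)))

    one-vertex : r ≡ 0 → (a b : Fin (suc r)) → a ≡ b
    one-vertex refl zero zero = refl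

    impossible : ⊥
    -- Both edges leave `vs i` in colour c, hence coincide; the cycle is then a loop, along which
    -- the height would have to drop.
    impossible with a , inc , a≡i⇒r≡0 ← backward C i =
      loopless {es (fromℕ r)} (subst (Joins G (es (fromℕ r)) (vs (fromℕ r)))
        (cong vs (one-vertex (a≡i⇒r≡0 (es-inj (arc-unique
          (trans (leaves inc) (sym (leaves (forward C i))))
          (trans (mono (es-in a)) (sym (mono (es-in i))))))) zero (fromℕ r))) close)

  -- The trees of the decomposition

  roots : Enumeration (λ r c → positive (pebbles r c)) ℓ
  roots = subst (Enumeration _)
    (trans (sum₂-cong (λ v c → ≤1⇒⟦positive⟧ (peb≤1 canonical v c))) sum₂-pebbles)
    (enumerate (λ r c → positive (pebbles r c)))

  open Enumeration roots renaming (injective to enum-injective)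

  -- The tree of colour c through v, identified by its root.
  tree : V → Fin k → Fin ℓ
  tree v c = proj₁ (complete (root v c , c) (1≤⇒positive (root-pebble v c)))

  enum-tree : ∀ v c → enum (tree v c) ≡ (root v c , c)
  enum-tree v c = proj₂ (complete (root v c , c) (1≤⇒positive (root-pebble v c)))

  rootOf : Fin ℓ → V
  rootOf j = proj₁ (enum j)

  colourOf : Fin ℓ → Fin k
  colourOf j = proj₂ (enum j)

  col : M → Fin ℓ
  col e = tree (tail e) (colour e)

  treeV : Fin ℓ → Subset (n G)
  treeV j = tabulate (λ v → does (root v (colourOf j) ≟ rootOf j))

  ∈-treeV⁺ : ∀ {v j} → root v (colourOf j) ≡ rootOf j → v ∈ˢ treeV j
  ∈-treeV⁺ {v} {j} h = ∈ˢ-tabulate⁺ {f = λ v → does (root v (colourOf j) ≟ rootOf j)} (dec-true (_ ≟ _) h)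

  ∈-treeV⁻ : ∀ {v j} → v ∈ˢ treeV j → root v (colourOf j) ≡ rootOf j
  ∈-treeV⁻ {v} {j} h = does⇒ {x = root v (colourOf j)} (∈ˢ-tabulate⁻ {f = λ v → does (root v (colourOf j) ≟ rootOf j)} h)

  ∈-tree : ∀ {u v c} → root v c ≡ root u c → v ∈ˢ treeV (tree u c)
  ∈-tree {u} {v} {c} h = ∈-treeV⁺ (subst (λ x → root v (proj₂ x) ≡ proj₁ x) (sym (enum-tree u c)) h)

  col≡⇒colour≡ : ∀ {e j} → col e ≡ j → colour e ≡ colourOf j
  col≡⇒colour≡ {e} refl = sym (cong proj₂ (enum-tree (tail e) (colour e)))

  tree≡ : ∀ {v j} → root v (colourOf j) ≡ rootOf j → tree v (colourOf j) ≡ j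
  tree≡ {v} {j} h = enum-injective (trans (enum-tree v (colourOf j)) (cong (_, colourOf j) h))

  subgraph : ∀ j → IsSubgraph G (treeV j) (tabulate (λ e → does (col e ≟ j)))
  subgraph j e e∈ with refl ← does⇒ {x = col e} {j} (∈ˢ-tabulate⁻ {f = λ e → does (col e ≟ j)} e∈) with arc-joins e
  ... | inj₁ eq rewrite eq = ∈-tree refl , ∈-tree (root-arc e)
  ... | inj₂ eq rewrite eq = ∈-tree (root-arc e) , ∈-tree refl

  -- Along the walk root and colour stay the same, so all its edges belong to tree j.
  reach-root : ∀ {j v r} → r ≡ rootOf j → root v (colourOf j) ≡ r → Leads arcs (colourOf j) v r → Reach G (λ e → col e ≡ j) v r
  reach-root r≡ root≡ ε = here
  reach-root {j} {v} r≡ root≡ (a ◅ p) with e , eq ← ∈-tabulate⁻ a =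
    reach-trans G (step e here col≡ joins-e) (reach-root r≡ (trans (sym (leads⇒root≡ (a ◅ ε))) root≡) p)
    where
    col≡ : col e ≡ j
    col≡ = trans (cong (λ x → tree (proj₁ x) (proj₂ (proj₂ x))) (sym eq)) (tree≡ (trans root≡ r≡))
    joins-e = subst (λ x → Joins G e (proj₁ x) (proj₁ (proj₂ x))) (sym eq) (arc-joins e)

  trees : ∀ j → IsTree G (treeV j) (λ e → col e ≡ j)
  trees j = (rootOf j , ∈-treeV⁺ (pebble⇒root≡ (positive⇒1≤ (sound j))))
          , (λ x y x∈ y∈ → reach-trans G (up x∈) (reach-sym G (up y∈)))
          , monochromatic⇒acyclic col≡⇒colour≡
    where
    up : ∀ {x} → x ∈ˢ treeV j → Reach G (λ e → col e ≡ j) x (rootOf j)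
    up {x} x∈ = reach-root refl (∈-treeV⁻ x∈) (subst (Leads arcs (colourOf j) x) (∈-treeV⁻ x∈) (to-root x (colourOf j)))

  -- Of each colour exactly one tree contains v, the one with the root of v; the trees are regrouped
  -- by colour.
  vertex-in-k-trees : ∀ v → ∣ tabulate (λ j → lookup (treeV j) v) ∣ ≡ k
  vertex-in-k-trees v = begin
    ∣ tabulate (λ j → lookup (treeV j) v) ∣                  ≡⟨ ∣tabulate∣ (λ j → lookup (treeV j) v) ⟩
    sum (λ j → ⟦ lookup (treeV j) v ⟧)                       ≡⟨ sum-cong-≗ by-tree ⟩
    sum (λ j → sum (λ c → f j c))                            ≡⟨ ∑-comm f ⟩
    sum (λ c → sum (λ j → f j c))                            ≡⟨ sum-cong-≗ by-colour ⟩
    sum {k} (λ c → 1)                                        ≡⟨ trans (sum-const k 1) (*-identityʳ k) ⟩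
    k                                                        ∎
    where
    open ≡-Reasoning
    f : Fin ℓ → Fin k → ℕ
    f j c = ⟦ at (rootOf j) (colourOf j) (root v c) c ⟧
    by-tree : ∀ j → ⟦ lookup (treeV j) v ⟧ ≡ sum (f j)
    by-tree j = trans (cong ⟦_⟧ (lookup∘tabulate (λ v → does (root v (colourOf j) ≟ rootOf j)) v))
      (sym (trans (sum-single (colourOf j) (λ c c≢ → cong ⟦_⟧ (at-false {v = rootOf j} {root v c} (c≢ ∘ proj₂))))
        (cong ⟦_⟧ (trans (cong (does (root v (colourOf j) ≟ rootOf j) ∧_) (dec-true (colourOf j ≟ colourOf j) refl))
                         (∧-identityʳ _)))))
    by-colour : ∀ c → sum (λ j → f j c) ≡ 1
    by-colour c = trans
      (sum-single (tree v c) (λ j j≢ → cong ⟦_⟧ (at-false {v = rootOf j} {root v c}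
        (λ (r≡ , c≡) → j≢ (enum-injective (trans (sym (cong₂ _,_ r≡ c≡)) (sym (enum-tree v c))))))))
      (cong ⟦_⟧ (trans (cong (λ x → at (proj₁ x) (proj₂ x) (root v c) c) (enum-tree v c)) (at-refl (root v c) c)))

  decomposition : Decomposition G k ℓ
  decomposition = record
    { col = col ; treeV = treeV ; sub = subgraph ; isTree = trees ; k-trees = vertex-in-k-trees }

  -- The tree-pieces of (V′ , E′) are represented by the pairs (v , c) with v in V′ having no
  -- outgoing edge of colour c in E′; there are k|V′| − |E′| of them.
  module Pieces (V′ : Subset (n G)) (E′ : Subset (m G)) (sub : IsSubgraph G V′ E′) where

    top : V → Fin k → Bool
    top v c = lookup V′ v ∧ not (positive (out (lookup E′) v c))

    tail∈ : ∀ {e} → lookup E′ e ≡ true → lookup V′ (tail e) ≡ true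
    tail∈ {e} h with arc-joins e
    ... | inj₁ eq = ∈ˢ⇒lookup (subst (λ x → proj₁ x ∈ˢ V′) eq (proj₁ (sub e (lookup⇒∈ˢ h))))
    ... | inj₂ eq = ∈ˢ⇒lookup (subst (λ x → proj₂ x ∈ˢ V′) eq (proj₂ (sub e (lookup⇒∈ˢ h))))

    -- A vertex of V′ is either a top in colour c or the tail of exactly one edge of that colour in
    -- E′. Outside V′ neither occurs, since edges of E′ have their tails in V′.
    top+out : ∀ v c → ⟦ top v c ⟧ + out (lookup E′) v c ≡ ⟦ lookup V′ v ⟧
    top+out v c with lookup V′ v in eq
    ... | true with out (lookup E′) v c | out≤1 (lookup E′) v c
    ...   | zero        | _ = refl
    ...   | suc zero    | _ = refl
    ...   | suc (suc _) | s≤s ()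
    top+out v c | false = sum-zero none
      where
      none : ∀ e → ⟦ lookup E′ e ∧ at (tail e) (colour e) v c ⟧ ≡ 0
      none e with lookup E′ e in e∈ | at (tail e) (colour e) v c in at≡
      ... | false | _     = refl
      ... | true  | false = refl
      ... | true  | true  with refl , _ ← at-sound (tail e) v (colour e) c at≡ =
        contradiction (trans (sym (tail∈ e∈)) eq) λ ()

    count-tops : ∣ E′ ∣ + sum₂ (λ v c → ⟦ top v c ⟧) ≡ k * ∣ V′ ∣
    count-tops = begin
      ∣ E′ ∣ + sum₂ (λ v c → ⟦ top v c ⟧)                        ≡⟨ +-comm ∣ E′ ∣ _ ⟩
      sum₂ (λ v c → ⟦ top v c ⟧) + ∣ E′ ∣                        ≡⟨ cong (sum₂ (λ v c → ⟦ top v c ⟧) +_) (trans (∣∣-sum E′) (sym (sum₂-out (lookup E′)))) ⟩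
      sum₂ (λ v c → ⟦ top v c ⟧) + sum₂ (out (lookup E′))        ≡⟨ sum₂-+ (λ v c → ⟦ top v c ⟧) _ ⟨
      sum₂ (λ v c → ⟦ top v c ⟧ + out (lookup E′) v c)           ≡⟨ sum₂-cong top+out ⟩
      sum (λ v → sum {k} (λ c → ⟦ lookup V′ v ⟧))                ≡⟨ sum-cong-≗ (λ v → sum-const k ⟦ lookup V′ v ⟧) ⟩
      sum (λ v → k * ⟦ lookup V′ v ⟧)                            ≡⟨ *-distribˡ-sum k (λ v → ⟦ lookup V′ v ⟧) ⟨
      k * sum (λ v → ⟦ lookup V′ v ⟧)                            ≡⟨ cong (k *_) (∣∣-sum V′) ⟨
      k * ∣ V′ ∣                                                 ∎
      where open ≡-Reasoning

    Inner : Fin k → V → V → Set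
    Inner c a b = ∃ λ e → e ∈ˢ E′ × tail e ≡ a × head e ≡ b × colour e ≡ c

    top⇒terminal : ∀ {v c} → top v c ≡ true → ∀ {w} → ¬ Inner c v w
    top⇒terminal {v} {c} h (e , e∈ , refl , refl , refl) =
      absurd (proj₂ (∧-true {lookup V′ v} h)) (≤-trans
        (≤-reflexive (sym (cong₂ (λ a b → ⟦ a ∧ b ⟧) (∈ˢ⇒lookup e∈) (at-refl (tail e) (colour e)))))
        (term≤sum (λ e → ⟦ lookup E′ e ∧ at (tail e) (colour e) v c ⟧) e))
      where
      absurd : ∀ {a} → not (positive a) ≡ true → ¬ 1 ≤ a
      absurd {zero}  _ ()
      absurd {suc a} ()

    -- Whatever is connected to a top x leads to x. An edge traversed against its direction prolongs
    -- the walk; one traversed along it is the first edge of the walk already found, since no other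
    -- leaves its tail in that colour.
    reach⇒inner : ∀ {j x y} → (∀ {w} → ¬ Inner (colourOf j) x w) →
      Reach G (PieceEdge G decomposition E′ j) x y → Star (Inner (colourOf j)) y x
    reach⇒inner term here = ε
    reach⇒inner {j} term (step e p (col≡ , e∈) jn) with joins-cases G {e} (arc-joins e) jn
    ... | inj₂ (t≡ , h≡) = (e , e∈ , t≡ , h≡ , col≡⇒colour≡ col≡) ◅ reach⇒inner term p
    ... | inj₁ (t≡ , h≡) with reach⇒inner term p
    ...   | ε = contradiction (e , e∈ , t≡ , h≡ , col≡⇒colour≡ col≡) term
    ...   | (e′ , _ , t′≡ , h′≡ , c≡) ◅ q
      with refl ← arc-unique {e} {e′} (trans t≡ (sym t′≡)) (trans (col≡⇒colour≡ col≡) (sym c≡))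
      with refl ← trans (sym h≡) h′≡ = q

    inner-terminal : ∀ {c x y} → (∀ {w} → ¬ Inner c x w) → Star (Inner c) x y → x ≡ y
    inner-terminal term ε       = refl
    inner-terminal term (i ◅ _) = contradiction i term

    pieces : ℓ ≤ sum₂ (λ v c → ⟦ top v c ⟧) → AtLeastPieces G decomposition ℓ V′ E′
    pieces enough = (λ i → tree (v i) (c i) , v i)
      , (λ i → ∈-tree refl , lookup⇒∈ˢ (proj₁ (∧-true (top-pick i))))
      , distinct
      where
      open Enumeration (enumerate top) using () renaming (enum to enumTop; injective to enumTop-injective; sound to enumTop-sound)
      pick : Fin ℓ → V × Fin k
      pick i = enumTop (inject≤ i enough)
      v = λ i → proj₁ (pick i)
      c = λ i → proj₂ (pick i)
      top-pick : ∀ i → top (v i) (c i) ≡ true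
      top-pick i = enumTop-sound (inject≤ i enough)
      colour-tree : ∀ i → colourOf (tree (v i) (c i)) ≡ c i
      colour-tree i = cong proj₂ (enum-tree (v i) (c i))
      distinct : ∀ i i′ → i ≢ i′ → tree (v i) (c i) ≡ tree (v i′) (c i′) →
        ¬ Reach G (PieceEdge G decomposition E′ (tree (v i) (c i))) (v i) (v i′)
      distinct i i′ i≢i′ tree≡ reach = i≢i′ (Fin.inject≤-injective enough enough i i′
          (enumTop-injective (cong₂ _,_ v≡ c≡)))
        where
        c≡ : c i ≡ c i′
        c≡ = trans (sym (colour-tree i)) (trans (cong colourOf tree≡) (colour-tree i′))
        term : ∀ i {c′} → c′ ≡ c i → ∀ {w} → ¬ Inner c′ (v i) w
        term i refl = top⇒terminal (top-pick i)
        v≡ : v i ≡ v i′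
        -- The piece leads from `v i′` to `v i`, but no inner edge leaves the top `v i′`.
        v≡ = sym (inner-terminal (term i′ (trans (colour-tree i) c≡)) (reach⇒inner (term i (colour-tree i)) reach))

  sparse⇒proper : Sparse G k ℓ → Proper G decomposition
  sparse⇒proper sp V′ E′ sub nonempty cond = pieces (+-cancelˡ-≤ ∣ E′ ∣ _ _
    (≤-trans (bound cond) (≤-reflexive (sym count-tops))))
    where
    open Pieces V′ E′ sub
    bound : Nonempty E′ ⊎ ℓ ≤ k → ∣ E′ ∣ + ℓ ≤ k * ∣ V′ ∣
    bound cond with 1 ≤? ∣ E′ ∣ | cond
    ... | yes h | _          = sp V′ E′ sub h
    ... | no ¬h | inj₁ ne    = contradiction (nonempty⇒1≤∣∣ ne) ¬h
    -- Without edges, ℓ ≤ k and a single vertex of V′ suffice.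
    ... | no ¬h | inj₂ ℓ≤k  = subst (λ a → a + ℓ ≤ k * ∣ V′ ∣) (sym (n<1⇒n≡0 (≰⇒> ¬h)))
      (≤-trans ℓ≤k (≤-trans (≤-reflexive (sym (*-identityʳ k))) (*-monoʳ-≤ k (nonempty⇒1≤∣∣ nonempty))))

-- Proper decompositions force sparsity

snoc : ∀ {A : Set} {r} → (Fin r → A) → A → Fin (suc r) → A
snoc f a i with view i
... | ‵fromℕ          = a
... | ‵inj₁ {i = j} _ = f j

snoc-inject₁ : ∀ {A : Set} {r} (f : Fin r → A) {a} i → snoc f a (inject₁ i) ≡ f i
snoc-inject₁ f i rewrite view-inject₁ i = refl

snoc-fromℕ : ∀ {A : Set} {r} (f : Fin r → A) {a} → snoc f a (fromℕ r) ≡ a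
snoc-fromℕ {r = r} f rewrite view-fromℕ r = refl

snoc-all : ∀ {A : Set} {P : A → Set} {r} {f : Fin r → A} {a} → (∀ i → P (f i)) → P a → ∀ i → P (snoc f a i)
snoc-all Pf Pa i with view i
... | ‵fromℕ          = Pa
... | ‵inj₁ {i = j} _ = Pf j

snoc-injective : ∀ {A : Set} {r} {f : Fin r → A} {a} → Injective _≡_ _≡_ f → (∀ i → f i ≢ a) →
  Injective _≡_ _≡_ (snoc f a)
snoc-injective f-inj f≢a {i} {j} eq with view i | view j
... | ‵fromℕ  | ‵fromℕ  = refl
... | ‵fromℕ  | ‵inj₁ _ = contradiction (sym eq) (f≢a _)
... | ‵inj₁ _ | ‵fromℕ  = contradiction eq (f≢a _)
... | ‵inj₁ _ | ‵inj₁ _ = cong inject₁ (f-inj eq)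

-- Simple paths and cycles

module _ (G : Graph) where

  reach-map : ∀ {E E′ : Fin (m G) → Set} → (∀ {e} → E e → E′ e) → ∀ {x y} → Reach G E x y → Reach G E′ x y
  reach-map h here           = here
  reach-map h (step e p q j) = step e (reach-map h p) (h q) j

  -- Listed backwards, from y to x: `Reach` grows at y, and the new vertex is put in front.
  record SimplePath (E : Fin (m G) → Set) (x y : Fin (n G)) (r : ℕ) : Set where
    field
      vs     : Fin (suc r) → Fin (n G)
      es     : Fin r → Fin (m G)
      vs-inj : Injective _≡_ _≡_ vs
      es-inj : Injective _≡_ _≡_ es
      es-in  : ∀ i → E (es i)
      joins  : ∀ i → Joins G (es i) (vs (inject₁ i)) (vs (suc i))
      start  : vs zero ≡ y
      end    : vs (fromℕ r) ≡ x

  module _ {E : Fin (m G) → Set} {x : Fin (n G)} where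
    open SimplePath

    trivial-path : SimplePath E x x 0
    trivial-path = record
      { vs = λ _ → x ; es = λ () ; vs-inj = λ { {zero} {zero} _ → refl } ; es-inj = λ { {()} } ; es-in = λ ()
      ; joins = λ () ; start = refl ; end = refl }

    drop-first : ∀ {y r} (p : SimplePath E x y (suc r)) → SimplePath E x (vs p (suc zero)) r
    drop-first p = record
      { vs = vs p ∘ suc ; es = es p ∘ suc
      ; vs-inj = Fin.suc-injective ∘ vs-inj p ; es-inj = Fin.suc-injective ∘ es-inj p
      ; es-in = es-in p ∘ suc ; joins = joins p ∘ suc ; start = refl ; end = end p }

    drop-until : ∀ {y r} (p : SimplePath E x y r) i → ∃ (SimplePath E x (vs p i))
    drop-until {r = r} p zero = r , subst (λ y → SimplePath E x y r) (sym (start p)) p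
    drop-until {r = suc r} p (suc i) = drop-until (drop-first p) i

    extend : ∀ {y z r e} (p : SimplePath E x y r) → E e → Joins G e z y → (∀ i → vs p i ≢ z) →
      SimplePath E x z (suc r)
    extend {y} {z} {r} {e} p e∈ j fresh = record
      { vs     = λ { zero → z ; (suc i) → vs p i }
      ; es     = λ { zero → e ; (suc i) → es p i }
      ; vs-inj = λ { {zero} {zero} _ → refl
                   ; {zero} {suc i} eq → contradiction (sym eq) (fresh i)
                   ; {suc i} {zero} eq → contradiction eq (fresh i)
                   ; {suc i} {suc i′} eq → cong suc (vs-inj p eq) }
      ; es-inj = λ { {zero} {zero} _ → refl
                   ; {zero} {suc i} eq → contradiction (sym eq) (es-fresh i)
                   ; {suc i} {zero} eq → contradiction eq (es-fresh i)
                   ; {suc i} {suc i′} eq → cong suc (es-inj p eq) }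
      ; es-in  = λ { zero → e∈ ; (suc i) → es-in p i }
      ; joins  = λ { zero → subst (Joins G e z) (sym (start p)) j ; (suc i) → joins p i }
      ; start  = refl
      ; end    = end p
      }
      where
      -- A second occurrence of `e` would make its end z a vertex of the path.
      es-fresh : ∀ i → es p i ≢ e
      es-fresh i eq with joins-cases G {e} (subst (λ e → Joins G e _ _) eq (joins p i)) j
      ... | inj₁ (v≡z , _) = fresh _ v≡z
      ... | inj₂ (_ , v≡z) = fresh _ v≡z

    -- Loop erasure: when the walk returns to a vertex of the path, the path is cut back to that
    -- vertex.
    simple-path : ∀ {y} → Reach G E x y → ∃ (SimplePath E x y)
    simple-path here = 0 , trivial-path
    simple-path (step {z = z} e p e∈ j) with r , q ← simple-path p with Fin.any? (λ i → vs q i ≟ z)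
    ... | yes (i , refl) = drop-until q i
    ... | no fresh       = suc r , extend q e∈ (joins-sym G {e} j) (λ i eq → fresh (i , eq))

  -- Covers loops, where the path is trivial, and parallel edges, since `e` lies outside E and so
  -- differs from every edge of the path.
  closing-edge⇒cycle : ∀ {E E′ : Fin (m G) → Set} {x y e} → Reach G E x y → Joins G e x y → ¬ E e →
    (∀ {e} → E e → E′ e) → E′ e → Cycle G E′
  closing-edge⇒cycle {E} {E′} {e = e} p j e∉ E⊆E′ e∈ with r , q ← simple-path p = record
    { r      = r
    ; vs     = vs q
    ; es     = snoc (es q) e
    ; vs-inj = vs-inj q
    ; es-inj = snoc-injective (es-inj q) (λ i eq → e∉ (subst E eq (es-in q i)))
    ; es-in  = snoc-all {P = E′} (λ i → E⊆E′ (es-in q i)) e∈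
    ; joins  = λ i → subst (λ e → Joins G e _ _) (sym (snoc-inject₁ (es q) i)) (joins q i)
    ; close  = subst (λ e → Joins G e _ _) (sym (snoc-fromℕ (es q)))
                 (subst₂ (Joins G e) (sym (end q)) (sym (start q)) j)
    }
    where open SimplePath

-- Counting tree-pieces by merging components

module _ (G : Graph) {k ℓ : ℕ} (D : Decomposition G k ℓ) (V′ : Subset (n G)) (E′ : Subset (m G))
         (subgraph : IsSubgraph G V′ E′) where

  open Decomposition D

  member : Fin ℓ → Fin (n G) → Bool
  member j v = lookup (treeV j) v ∧ lookup V′ v

  end₁ end₂ : Fin (m G) → Fin (n G)
  end₁ e = proj₁ (ends G e)
  end₂ e = proj₂ (ends G e)

  ends-member : ∀ {e} → e ∈ˢ E′ → member (col e) (end₁ e) ≡ true × member (col e) (end₂ e) ≡ true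
  ends-member {e} e∈ =
    let t₁ , t₂ = sub (col e) e (∈ˢ-tabulate⁺ {f = λ e′ → does (col e′ ≟ col e)} (dec-true (col e ≟ col e) refl))
        v₁ , v₂ = subgraph e e∈
    in ∧-intro (∈ˢ⇒lookup t₁) (∈ˢ⇒lookup v₁) , ∧-intro (∈ˢ⇒lookup t₂) (∈ˢ⇒lookup v₂)

  Used : List (Fin (m G)) → Fin ℓ → Fin (m G) → Set
  Used es j e = col e ≡ j × e ∈ es

  -- A choice of one representative in every component of the graph formed by the vertex-tree
  -- incidences (j , v) and the edges in es; merging two components loses one representative.
  record Labelling (es : List (Fin (m G))) : Set where
    field
      label  : Fin ℓ → Fin (n G) → Fin (n G)
      keeps  : ∀ j v → member j v ≡ true → member j (label j v) ≡ true
      idem   : ∀ j v → label j (label j v) ≡ label j v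
      linked : ∀ {j x y} → label j x ≡ label j y → Reach G (Used es j) x y

    fixed : Fin ℓ → Fin (n G) → Bool
    fixed j v = member j v ∧ does (label j v ≟ v)

    field
      count  : length es + sum₂ (λ j v → ⟦ fixed j v ⟧) ≡ sum₂ (λ j v → ⟦ member j v ⟧)

  module Merge {e es} (L : Labelling es) (e∈ : e ∈ˢ E′) (e∉es : ¬ e ∈ es) where
    open Labelling L

    x y a b : Fin (n G)
    x = end₁ e
    y = end₂ e
    a = label (col e) x
    b = label (col e) y

    -- With equal labels the ends of `e` would already be connected inside its tree, and `e` would
    -- close a cycle there.
    a≢b : a ≢ b
    a≢b a≡b = proj₂ (proj₂ (isTree (col e))) (closing-edge⇒cycle G (linked a≡b) (inj₁ refl) (e∉es ∘ proj₂) proj₁ refl)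

    label′ : Fin ℓ → Fin (n G) → Fin (n G)
    label′ j v = if at (col e) a j (label j v) then b else label j v

    data Cases (j : Fin ℓ) (v : Fin (n G)) : Set where
      moved  : j ≡ col e → label j v ≡ a → label′ j v ≡ b → Cases j v
      stayed : ¬ (j ≡ col e × label j v ≡ a) → label′ j v ≡ label j v → Cases j v

    cases : ∀ j v → Cases j v
    cases j v with at (col e) a j (label j v) in eq
    ... | true  = let j≡ , l≡ = at-sound (col e) j a (label j v) eq in
                  moved j≡ l≡ (cong (λ c → if c then b else label j v) eq)
    ... | false = stayed (λ { (refl , l≡) → contradiction
                      (trans (sym (trans (cong (at (col e) a (col e)) l≡) (at-refl (col e) a))) eq) λ () })
                    (cong (λ c → if c then b else label j v) eq)

    labelling : Labelling (e ∷ es)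
    labelling = record
      { label = label′ ; keeps = keeps′ ; idem = idem′ ; linked = linked′ ; count = count′ }
      where
      weaken : ∀ {j u v} → Reach G (Used es j) u v → Reach G (Used (e ∷ es) j) u v
      weaken = reach-map G (λ (c , e∈) → c , there e∈)

      keeps′ : ∀ j v → member j v ≡ true → member j (label′ j v) ≡ true
      keeps′ j v h with cases j v
      ... | moved refl _ eq = subst (λ u → member j u ≡ true) (sym eq) (keeps j y (proj₂ (ends-member e∈)))
      ... | stayed _ eq     = subst (λ u → member j u ≡ true) (sym eq) (keeps j v h)

      label′-b : label′ (col e) b ≡ b
      label′-b with cases (col e) b
      ... | moved _ _ eq  = eq
      ... | stayed _ eq   = trans eq (idem (col e) y)

      idem′ : ∀ j v → label′ j (label′ j v) ≡ label′ j v
      idem′ j v with cases j v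
      ... | moved refl _ eq = trans (cong (label′ j) eq) (trans label′-b (sym eq))
      ... | stayed ne eq with cases j (label j v)
      ...   | moved j≡ l≡ _ = contradiction (j≡ , trans (sym (idem j v)) l≡) ne
      ...   | stayed _ eq′  = trans (cong (label′ j) eq) (trans eq′ (trans (idem j v) (sym eq)))

      through : ∀ {u v} → label (col e) u ≡ a → label (col e) v ≡ b → Reach G (Used (e ∷ es) (col e)) u v
      through u≡a v≡b = reach-trans G
        (step e (weaken (linked u≡a)) (refl , here refl) (inj₁ refl)) (weaken (linked (sym v≡b)))

      linked′ : ∀ {j u v} → label′ j u ≡ label′ j v → Reach G (Used (e ∷ es) j) u v
      linked′ {j} {u} {v} eq with cases j u | cases j v
      ... | moved refl u≡a _   | moved _ v≡a _      = weaken (linked (trans u≡a (sym v≡a)))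
      ... | moved refl u≡a u′  | stayed _ v′        = through u≡a (trans (sym v′) (trans (sym eq) u′))
      ... | stayed _ u′        | moved refl v≡a v′  = reach-sym G (through v≡a (trans (sym u′) (trans eq v′)))
      ... | stayed _ u′        | stayed _ v′        = weaken (linked (trans (sym u′) (trans eq v′)))

      fixed′ : Fin ℓ → Fin (n G) → Bool
      fixed′ j v = member j v ∧ does (label′ j v ≟ v)

      -- Only (col e , a) ceases to be a representative. Any other v relabelled from a to b was none
      -- before, and is none now: v = b would have had label b, not a.
      lose-one : ∀ j v → ⟦ fixed′ j v ⟧ + ⟦ at (col e) a j v ⟧ ≡ ⟦ fixed j v ⟧
      lose-one j v with cases j v
      ... | stayed ne eq rewrite eq = trans (cong (λ c → ⟦ fixed j v ⟧ + ⟦ c ⟧)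
              (at-false {v = col e} {j} {a} {v} (λ { (refl , refl) → ne (refl , idem (col e) x) }))) (+-identityʳ _)
      ... | moved refl l≡ eq with v ≟ a
      ...   | yes refl = trans (cong₂ (λ c d → ⟦ c ⟧ + ⟦ d ⟧)
                (trans (cong (member (col e) a ∧_) (dec-false (_ ≟ _) (λ l → a≢b (trans (sym l) eq)))) (∧-zeroʳ _))
                (cong₂ _∧_ (dec-true (col e ≟ col e) refl) refl))
                (sym (cong ⟦_⟧ (∧-intro (keeps (col e) x (proj₁ (ends-member e∈))) (dec-true (_ ≟ _) l≡))))
      ...   | no v≢a = trans (cong₂ (λ c d → ⟦ c ⟧ + ⟦ d ⟧)
                (trans (cong (member (col e) v ∧_) (dec-false (_ ≟ _) not-b)) (∧-zeroʳ _)) (∧-zeroʳ _))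
                (sym (cong ⟦_⟧ (trans (cong (member (col e) v ∧_) (dec-false (_ ≟ _) (λ l → v≢a (trans (sym l) l≡)))) (∧-zeroʳ _))))
        where
        not-b : label′ (col e) v ≢ v
        not-b l = a≢b (trans (sym l≡) (trans (cong (label (col e)) (trans (sym l) eq)) (idem (col e) y)))

      count′ : suc (length es) + sum₂ (λ j v → ⟦ fixed′ j v ⟧) ≡ sum₂ (λ j v → ⟦ member j v ⟧)
      count′ = begin
        suc (length es) + sum₂ (λ j v → ⟦ fixed′ j v ⟧)
          ≡⟨ +-suc (length es) _ ⟨
        length es + suc (sum₂ (λ j v → ⟦ fixed′ j v ⟧))
          ≡⟨ cong (length es +_) (+-comm 1 _) ⟩
        length es + (sum₂ (λ j v → ⟦ fixed′ j v ⟧) + 1)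
          ≡⟨ cong (λ s → length es + (sum₂ (λ j v → ⟦ fixed′ j v ⟧) + s)) (sum₂-at (col e) a) ⟨
        length es + (sum₂ (λ j v → ⟦ fixed′ j v ⟧) + sum₂ (λ j v → ⟦ at (col e) a j v ⟧))
          ≡⟨ cong (length es +_) (sum₂-+ (λ j v → ⟦ fixed′ j v ⟧) _) ⟨
        length es + sum₂ (λ j v → ⟦ fixed′ j v ⟧ + ⟦ at (col e) a j v ⟧)
          ≡⟨ cong (length es +_) (sum₂-cong lose-one) ⟩
        length es + sum₂ (λ j v → ⟦ fixed j v ⟧)
          ≡⟨ count ⟩
        sum₂ (λ j v → ⟦ member j v ⟧) ∎
        where open ≡-Reasoning

  label-all : ∀ {es} → All (_∈ˢ E′) es → Unique es → Labelling es
  label-all [] [] = record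
    { label  = λ _ v → v
    ; keeps  = λ _ _ → id
    ; idem   = λ _ _ → refl
    ; linked = λ { refl → here }
    ; count  = sum₂-cong (λ j v → cong ⟦_⟧ (trans (cong (member j v ∧_) (dec-true (v ≟ v) refl)) (∧-identityʳ _)))
    }
  label-all (e∈ ∷ es∈) (e∉ ∷ u) = Merge.labelling (label-all es∈ u) e∈ (λ e∈es → All.lookup e∉ e∈es refl)

  edge-list : List (Fin (m G))
  edge-list = filter (λ e → lookup E′ e ≟ᵇ true) (allFin (m G))

  edge-list⊆E′ : ∀ {e} → e ∈ edge-list → e ∈ˢ E′
  edge-list⊆E′ e∈ = lookup⇒∈ˢ (proj₂ (∈-filter⁻ (λ e → lookup E′ e ≟ᵇ true) {xs = allFin (m G)} e∈))

  -- Double counting: every vertex of V′ lies in k trees.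
  count-members : sum₂ (λ j v → ⟦ member j v ⟧) ≡ k * ∣ V′ ∣
  count-members = begin
    sum₂ (λ j v → ⟦ member j v ⟧)                    ≡⟨ ∑-comm (λ j v → ⟦ member j v ⟧) ⟩
    sum (λ v → sum (λ j → ⟦ member j v ⟧))           ≡⟨ sum-cong-≗ by-vertex ⟩
    sum (λ v → k * ⟦ lookup V′ v ⟧)                  ≡⟨ *-distribˡ-sum k (λ v → ⟦ lookup V′ v ⟧) ⟨
    k * sum (λ v → ⟦ lookup V′ v ⟧)                  ≡⟨ cong (k *_) (∣∣-sum V′) ⟨
    k * ∣ V′ ∣                                       ∎
    where
    open ≡-Reasoning
    by-vertex : ∀ v → sum (λ j → ⟦ member j v ⟧) ≡ k * ⟦ lookup V′ v ⟧
    by-vertex v with lookup V′ v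
    ... | true  = trans (sum-cong-≗ (λ j → cong ⟦_⟧ (∧-identityʳ (lookup (treeV j) v))))
      (trans (sym (∣tabulate∣ (λ j → lookup (treeV j) v))) (trans (k-trees v) (sym (*-identityʳ k))))
    ... | false = trans (sum-zero (λ j → cong ⟦_⟧ (∧-zeroʳ (lookup (treeV j) v)))) (sym (*-zeroʳ k))

  -- Vertices chosen in different pieces of a tree have different labels, so the pieces are at most
  -- as many as the fixed incidences; once all edges of E′ are merged in, kn′ - m′ of these are
  -- left.
  pieces-bound : ∀ {s} → AtLeastPieces G D s V′ E′ → ∣ E′ ∣ + s ≤ k * ∣ V′ ∣
  pieces-bound {s} (f , f∈ , apart) = begin
    ∣ E′ ∣ + s                                              ≤⟨ +-monoʳ-≤ ∣ E′ ∣ (injection⇒≤sum₂ fixed rep rep-injective rep-fixed) ⟩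
    ∣ E′ ∣ + sum₂ (λ j v → ⟦ fixed j v ⟧)                   ≡⟨ cong (_+ sum₂ (λ j v → ⟦ fixed j v ⟧)) (trans (length-filter-tabulate (lookup E′) id) (sym (∣∣-sum E′))) ⟨
    length edge-list + sum₂ (λ j v → ⟦ fixed j v ⟧)         ≡⟨ count ⟩
    sum₂ (λ j v → ⟦ member j v ⟧)                           ≡⟨ count-members ⟩
    k * ∣ V′ ∣                                              ∎
    where
    open ≤-Reasoning
    open Labelling (label-all {edge-list} (All.tabulate edge-list⊆E′) (filter⁺ (λ e → lookup E′ e ≟ᵇ true) (allFin⁺ (m G))))
    rep : Fin s → Fin ℓ × Fin (n G)
    rep i = proj₁ (f i) , label (proj₁ (f i)) (proj₂ (f i))
    rep-fixed : ∀ i → fixed (proj₁ (rep i)) (proj₂ (rep i)) ≡ true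
    rep-fixed i = ∧-intro
      (keeps _ _ (∧-intro (∈ˢ⇒lookup (proj₁ (f∈ i))) (∈ˢ⇒lookup (proj₂ (f∈ i)))))
      (dec-true (_ ≟ _) (idem _ _))
    rep-injective : Injective _≡_ _≡_ rep
    rep-injective {i} {i′} eq with i ≟ i′
    ... | yes i≡i′ = i≡i′
    ... | no i≢i′  = contradiction
      (reach-map G (λ (c , e∈) → c , edge-list⊆E′ e∈)
        (linked (trans (cong proj₂ eq) (cong (λ j → label j (proj₂ (f i′))) (sym (cong proj₁ eq))))))
      (apart i i′ i≢i′ (cong proj₁ eq))

proper⇒sparse : ∀ (G : Graph) {k ℓ} → HasProperDecomposition G k ℓ → Sparse G k ℓ
proper⇒sparse G {k} {ℓ} (D , proper) V′ E′ sub 1≤E′ =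
  pieces-bound G D V′ E′ sub (proper V′ E′ sub (proj₁ (proj₁ nonempty) , proj₂ (proj₁ nonempty)) (inj₁ (proj₂ nonempty)))
  where
  nonempty : Nonempty V′ × Nonempty E′
  nonempty with e , h ← sum-positive (λ e → ⟦ lookup E′ e ⟧) (subst (1 ≤_) (∣∣-sum E′) 1≤E′)
    with lookup E′ e in eq | h
  ... | true | _ = (_ , proj₁ (sub e (lookup⇒∈ˢ eq))) , (e , lookup⇒∈ˢ eq)

theorem4 : (k ℓ : ℕ) → k ≤ ℓ → ℓ < 2 * k → (G : Graph) →
    (PebbleGameGraph k ℓ G × Tight G k ℓ) ⇔ (HasProperDecomposition G k ℓ × HasTightCount G k ℓ)
theorem4 k ℓ k≤ℓ _ G = mk⇔
  (λ (_ , sparse , count) →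
    let open Forests G k ℓ (sparse⇒orientation G k ℓ k≤ℓ sparse) count
    in (decomposition , sparse⇒proper sparse) , count)
  (λ (proper , count) →
    let sparse = proper⇒sparse G proper
    in orientation⇒game G k ℓ (sparse⇒orientation G k ℓ k≤ℓ sparse) , sparse , count)
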